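{- Let $k\geq 2$ and $n\geq (2k)^{9k^2}$ be integers and let $\varepsilon\in\left(0,\frac{1}{2000k^2}\right)$ be real. Let $G$ be a maximal $C_{2k+1}$-free graph on $n$ vertices with $e(G)=\frac{n^2}{4}-\varepsilon n^{3/2}$. Then $G$ contains an induced complete bipartite subgraph on at least $(1-250k^2\varepsilon)n$ vertices.
   Context: $C_{2k+1}$ denotes the cycle of length $2k+1$. A graph $G$ is maximal $C_{2k+1}$-free if it contains no subgraph isomorphic to $C_{2k+1}$ and adding any edge of the complement of $G$ to $G$ creates a copy of $C_{2k+1}$. $e(G)$ is the number of edges of $G$. Graphs are finite and simple. -}

module Defs where

open import Data.Nat using (ℕ; zero; suc; _+_; _*_; _∸_; _^_; _≤_; _<_)
open import Data.Fin using (Fin; zero; suc; inject₁; fromℕ; _≟_; _<?_)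
open import Data.Fin.Subset using (Subset; _∈_; ∣_∣; Nonempty)
open import Data.Bool using (Bool; true; false; _∧_; _∨_; if_then_else_)
open import Data.List using (List; map; allFin)
open import Data.Nat.ListAction using (sum)
open import Data.Product using (Σ; _×_; ∃)
open import Data.Empty using (⊥)
open import Relation.Nullary using (¬_; does)
open import Relation.Binary.PropositionalEquality using (_≡_)
open import Function.Definitions using (Injective)

record Graph (n : ℕ) : Set where
  field
    adj    : Fin n → Fin n → Bool
    sym    : ∀ x y → adj x y ≡ adj y x
    irrefl : ∀ x → adj x x ≡ false
open Graph public

edgeCount : ∀ {n} → Graph n → ℕ
edgeCount {n} G =
  sum (map (λ x → sum (map (λ y → if adj G x y ∧ does (x <? y) then 1 else 0)
                           (allFin n)))
           (allFin n))

-- the adjacency relation E contains a cycle of length suc m (m ≥ 2 intended):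
-- an injective sequence of suc m vertices, consecutive ones adjacent, last adjacent to first.
ContainsCycle : ∀ {n} → (Fin n → Fin n → Bool) → ℕ → Set
ContainsCycle {n} E zero = ⊥
ContainsCycle {n} E (suc m) =
  Σ (Fin (suc m) → Fin n) λ f →
    Injective _≡_ _≡_ f
    × (∀ (i : Fin m) → E (f (inject₁ i)) (f (suc i)) ≡ true)
    × (E (f (fromℕ m)) (f zero) ≡ true)

addEdge : ∀ {n} → Graph n → Fin n → Fin n → Fin n → Fin n → Bool
addEdge G u v x y =
  adj G x y ∨ (does (x ≟ u) ∧ does (y ≟ v)) ∨ (does (x ≟ v) ∧ does (y ≟ u))

CycleFree : ∀ {n} → ℕ → Graph n → Set
CycleFree L G = ¬ ContainsCycle (adj G) L

MaximalCycleFree : ∀ {n} → ℕ → Graph n → Set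
MaximalCycleFree L G =
  CycleFree L G ×
  (∀ u v → ¬ (u ≡ v) → adj G u v ≡ false → ContainsCycle (addEdge G u v) L)

InducedCompleteBipartite : ∀ {n} → Graph n → Subset n → Subset n → Set
InducedCompleteBipartite G A B =
  Nonempty A × Nonempty B
  × (∀ x → x ∈ A → x ∈ B → ⊥)
  × (∀ x y → x ∈ A → y ∈ B → adj G x y ≡ true)
  × (∀ x y → x ∈ A → y ∈ A → adj G x y ≡ false)
  × (∀ x y → x ∈ B → y ∈ B → adj G x y ≡ false)

{-# OPTIONS --safe #-}

-- Delete vertices of degree below s/2 - c/4 (s the current order, c ≈ n/4) until a set S remains.
-- As a C₂ₖ₊₁-free graph has at most s²/4 + O(ks) edges, only a small set T is deleted. Among any
-- three neighbourhoods in S two have a large intersection, and two vertices with many common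
-- neighbours are joined by paths of length 2 avoiding any few vertices; this makes G[S] bipartite,
-- with parts X and Y, and lets one close any short path with ends in S and wrong parity up to
-- a cycle of length 2k+1. Now 4e(G[S]) ≤ s² gives |T| = O(D/n), where D = n² - 4e(G), and at most
-- D/4 pairs in X × Y are non-adjacent. For such a pair x, y maximality yields a path of length 2k,
-- whose interior must lie in T, so for the neighbour v ∈ T of y on it x misses all of N(v) ∩ Y.
-- Hence it suffices to delete the x ∈ X missing more than √n vertices of Y, and the sets N(v) ∩ Y
-- with v ∈ T that have at most √n elements: O(D/√n) vertices altogether.
module Submission where

open import Defs
open import Data.Nat using (ℕ; zero; suc; _+_; _*_; _∸_; _^_; _≤_; _<_; z≤n; s≤s; s<s; _/_; _%_)
open import Data.Nat.DivMod using (m≡m%n+[m/n]*n; m%n<n)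
open import Data.Nat.Properties hiding (_≟_)
open import Data.Nat.Tactic.RingSolver using (solve-∀; solve)
open import Data.Fin using (Fin; zero; suc; inject₁; fromℕ; toℕ; fromℕ<; _≟_)
  renaming (_<?_ to _<?ᶠ_)
import Data.Fin.Properties as Finₚ
import Data.Vec as Vec
open import Data.Vec.Properties using (lookup⇒[]=; []=⇒lookup; lookup∘tabulate)
open import Data.Fin.Subset using (Subset; _∈_; ∣_∣; Nonempty)
open import Data.Bool using (Bool; true; false; _∧_; _∨_; not; if_then_else_)
open import Data.Bool.Properties using () renaming (_≟_ to _≟ᵇ_)
open import Data.List using (map; allFin; tabulate; _∷_; [])
open import Data.List.Properties using (map-tabulate)
open import Data.Nat.ListAction using () renaming (sum to sumᴸ)
open import Data.Product using (Σ; _×_; ∃; _,_; proj₁; proj₂)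
open import Data.Sum using (_⊎_; inj₁; inj₂)
open import Data.Empty using (⊥; ⊥-elim)
open import Function using (_∘_; id; case_of_)
open import Relation.Nullary using (¬_; Dec; yes; no; does)
open import Relation.Nullary.Decidable using (_×-dec_)
open import Relation.Binary.Definitions using (tri<; tri≈; tri>)
open import Relation.Binary.PropositionalEquality
  using (_≡_; _≢_; refl; trans; cong; cong₂; subst; subst₂) renaming (sym to ≡-sym)
open import Algebra.Properties.Semiring.Sum +-*-semiring
  using (sum; sum-cong-≗; ∑-distrib-+; ∑-comm; *-distribˡ-sum; *-distribʳ-sum; sum-replicate-zero)

-- Counting with Boolean predicates

Pred : ℕ → Set
Pred n = Fin n → Bool

⟦_⟧ : Bool → ℕ
⟦ b ⟧ = if b then 1 else 0

# : ∀ {n} → Pred n → ℕ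
# p = sum (λ i → ⟦ p i ⟧)

sum-mono : ∀ {n} {f g : Fin n → ℕ} → (∀ i → f i ≤ g i) → sum f ≤ sum g
sum-mono {zero}  h = z≤n
sum-mono {suc n} h = +-mono-≤ (h zero) (sum-mono (h ∘ suc))

⟦⟧-mono : ∀ {a b} → (a ≡ true → b ≡ true) → ⟦ a ⟧ ≤ ⟦ b ⟧
⟦⟧-mono {false}         h = z≤n
⟦⟧-mono {true}  {false} h = case h refl of λ ()
⟦⟧-mono {true}  {true}  h = ≤-refl

#-mono : ∀ {n} (p q : Pred n) → (∀ i → p i ≡ true → q i ≡ true) → # p ≤ # q
#-mono p q h = sum-mono (λ i → ⟦⟧-mono (h i))

≤-sum : ∀ {n} (f : Fin n → ℕ) i → f i ≤ sum f
≤-sum f zero    = m≤m+n _ _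
≤-sum f (suc i) = ≤-trans (≤-sum (f ∘ suc) i) (m≤n+m _ _)

#-all : ∀ n → # {n} (λ _ → true) ≡ n
#-all zero    = refl
#-all (suc n) = cong suc (#-all n)

#-none : ∀ {n} {p : Pred n} → (∀ i → p i ≡ false) → # p ≡ 0
#-none {n} h = trans (sum-cong-≗ (λ i → cong ⟦_⟧ (h i))) (sum-replicate-zero n)

#-pos⇒∃ : ∀ {n} (p : Pred n) → 0 < # p → ∃ λ i → p i ≡ true
#-pos⇒∃ {suc n} p h with p zero in eq
... | true  = zero , eq
... | false = let (i , pi) = #-pos⇒∃ (p ∘ suc) h in suc i , pi

∃⇒#-pos : ∀ {n} (p : Pred n) i → p i ≡ true → 0 < # p
∃⇒#-pos p i pi = ≤-trans (≤-reflexive (cong ⟦_⟧ (≡-sym pi))) (≤-sum (λ j → ⟦ p j ⟧) i)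

sum-at : ∀ {n} x (f : Fin n → ℕ) → sum (λ y → ⟦ does (y ≟ x) ⟧ * f y) ≡ f x
sum-at {suc n} zero f =
  trans (cong₂ _+_ (+-identityʳ (f zero)) (sum-replicate-zero n)) (+-identityʳ _)
sum-at {suc n} (suc x) f = sum-at x (f ∘ suc)

≟-refl : ∀ {n} (x : Fin n) → does (x ≟ x) ≡ true
≟-refl x with x ≟ x
... | yes _  = refl
... | no x≢x = ⊥-elim (x≢x refl)

∧-fst : ∀ {a b} → a ∧ b ≡ true → a ≡ true
∧-fst {true} _ = refl

∧-snd : ∀ {a b} → a ∧ b ≡ true → b ≡ true
∧-snd {true} h = h

∧-intro : ∀ {a b} → a ≡ true → b ≡ true → a ∧ b ≡ true
∧-intro refl refl = refl

true≢false : ∀ {b} → b ≡ true → b ≡ false → ⊥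
true≢false refl ()

not-true : ∀ {b} → not b ≡ true → b ≡ false
not-true {false} _ = refl

infixl 6 _∖_
_∖_ : ∀ {n} → Pred n → Fin n → Pred n
(p ∖ x) y = p y ∧ not (does (y ≟ x))

∖-≢ : ∀ {n} {p : Pred n} {x y} → (p ∖ x) y ≡ true → y ≢ x
∖-≢ {p = p} {x} h refl = true≢false (≟-refl x) (not-true (∧-snd {p x} h))

#-≟ : ∀ {n} (x : Fin n) → # (λ y → does (y ≟ x)) ≡ 1
#-≟ {n} x = trans (sum-cong-≗ {n} (λ y → ≡-sym (*-identityʳ _))) (sum-at x (λ _ → 1))

#-∖ : ∀ {n} (p : Pred n) x → # p ≤ suc (# (p ∖ x))
#-∖ p x = begin
  # p                                                     ≤⟨ sum-mono (λ y → pointwise (p y) (does (y ≟ x))) ⟩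
  sum (λ y → ⟦ does (y ≟ x) ⟧ + ⟦ (p ∖ x) y ⟧)            ≡⟨ ∑-distrib-+ (λ y → ⟦ does (y ≟ x) ⟧) (λ y → ⟦ (p ∖ x) y ⟧) ⟩
  # (λ y → does (y ≟ x)) + # (p ∖ x)                      ≡⟨ cong (_+ # (p ∖ x)) (#-≟ x) ⟩
  suc (# (p ∖ x))                                         ∎
  where
  open ≤-Reasoning
  pointwise : ∀ a b → ⟦ a ⟧ ≤ ⟦ b ⟧ + ⟦ a ∧ not b ⟧
  pointwise false b     = z≤n
  pointwise true  false = ≤-refl
  pointwise true  true  = ≤-refl

#-∖-∈ : ∀ {n} (p : Pred n) x → p x ≡ true → # p ≡ suc (# (p ∖ x))
#-∖-∈ {n} p x px = begin-equality
  # p                                                      ≡⟨ sum-cong-≗ {n} pointwise ⟩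
  sum (λ y → ⟦ does (y ≟ x) ⟧ + ⟦ (p ∖ x) y ⟧)             ≡⟨ ∑-distrib-+ (λ y → ⟦ does (y ≟ x) ⟧) (λ y → ⟦ (p ∖ x) y ⟧) ⟩
  # (λ y → does (y ≟ x)) + # (p ∖ x)                       ≡⟨ cong (_+ # (p ∖ x)) (#-≟ x) ⟩
  suc (# (p ∖ x))                                          ∎
  where
  open ≤-Reasoning
  pointwise : ∀ y → ⟦ p y ⟧ ≡ ⟦ does (y ≟ x) ⟧ + ⟦ (p ∖ x) y ⟧
  pointwise y with y ≟ x
  pointwise y | yes refl rewrite px = refl
  pointwise y | no _ with p y
  ... | true  = refl
  ... | false = refl

-- Fresh vertices and paths

fresh : ∀ {n} m (p : ℕ → Fin n) (q : Pred n) → m < # q →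
        ∃ λ z → q z ≡ true × (∀ i → i < m → z ≢ p i)
fresh zero p q m<q = let (z , qz) = #-pos⇒∃ q m<q in z , qz , λ _ ()
fresh (suc m) p q m<q
  with fresh m p (q ∖ p m) (≤-pred (≤-trans m<q (#-∖ q (p m))))
... | z , q′z , z≢ = z , ∧-fst q′z , λ i i<1+m → case m≤n⇒m<n∨m≡n (≤-pred i<1+m) of λ where
  (inj₁ i<m)  → z≢ i i<m
  (inj₂ refl) → ∖-≢ {p = q} q′z

-- Only the vertices p 0, …, p l matter.
Path : ∀ {n} → Graph n → ℕ → (ℕ → Fin n) → Set
Path G l p = (∀ i → i < l → adj G (p i) (p (suc i)) ≡ true)
           × (∀ i j → i < j → j ≤ l → p i ≢ p j)

infixr 5 _◂_
_◂_ : ∀ {A : Set} → A → (ℕ → A) → ℕ → A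
(z ◂ p) zero    = z
(z ◂ p) (suc i) = p i

Path-◂ : ∀ {n} (G : Graph n) {l p z} → Path G l p → adj G z (p 0) ≡ true →
         (∀ i → i ≤ l → z ≢ p i) → Path G (suc l) (z ◂ p)
Path-◂ G {l} {p} {z} (edge , inj) zp₀ z∉ = edge′ , inj′
  where
  edge′ : ∀ i → i < suc l → adj G ((z ◂ p) i) ((z ◂ p) (suc i)) ≡ true
  edge′ zero    _         = zp₀
  edge′ (suc i) (s≤s i<l) = edge i i<l
  inj′ : ∀ i j → i < j → j ≤ suc l → (z ◂ p) i ≢ (z ◂ p) j
  inj′ zero    (suc j) _         (s≤s j≤l) = z∉ j j≤l
  inj′ (suc i) (suc j) (s<s i<j) (s≤s j≤l) = inj i j i<j j≤l

Path-∙ : ∀ {n} (G : Graph n) x → Path G 0 (λ _ → x)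
Path-∙ G x = (λ _ ()) , λ { i zero () z≤n }

Path-prefix : ∀ {n} (G : Graph n) {l m p} → Path G l p → m ≤ l → Path G m p
Path-prefix G (edge , inj) m≤l =
  (λ i i<m → edge i (≤-trans i<m m≤l)) , λ i j i<j j≤m → inj i j i<j (≤-trans j≤m m≤l)

Path-suffix : ∀ {n} (G : Graph n) a {b p} → Path G (a + b) p → Path G b (λ i → p (a + i))
Path-suffix G a {b} {p} (edge , inj) =
  (λ i i<b → subst (λ s → adj G (p (a + i)) (p s) ≡ true) (≡-sym (+-suc a i))
               (edge (a + i) (+-monoʳ-< a i<b))) ,
  λ i j i<j j≤b → inj (a + i) (a + j) (+-monoʳ-< a i<j) (+-monoʳ-≤ a j≤b)

Path-close : ∀ {n} (G : Graph n) {l p} → Path G l p → adj G (p l) (p 0) ≡ true →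
             ContainsCycle (adj G) (suc l)
Path-close G {l} {p} (edge , inj) closing = (λ i → p (toℕ i)) , injective , consecutive , last
  where
  injective : ∀ {i j : Fin (suc l)} → p (toℕ i) ≡ p (toℕ j) → i ≡ j
  injective {i} {j} eq with <-cmp (toℕ i) (toℕ j)
  ... | tri< i<j _ _ = ⊥-elim (inj _ _ i<j (Finₚ.toℕ≤pred[n] j) eq)
  ... | tri≈ _ i≡j _ = Finₚ.toℕ-injective i≡j
  ... | tri> _ _ j<i = ⊥-elim (inj _ _ j<i (Finₚ.toℕ≤pred[n] i) (≡-sym eq))
  consecutive : ∀ (i : Fin l) → adj G (p (toℕ (inject₁ i))) (p (suc (toℕ i))) ≡ true
  consecutive i rewrite Finₚ.toℕ-inject₁ i = edge (toℕ i) (Finₚ.toℕ<n i)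
  last : adj G (p (toℕ (fromℕ l))) (p 0) ≡ true
  last rewrite Finₚ.toℕ-fromℕ l = closing

-- Closing paths through common neighbours

nbrs : ∀ {n} → Graph n → Pred n → Fin n → Pred n
nbrs G S x z = S z ∧ adj G x z

joint : ∀ {n} → Graph n → Pred n → Fin n → Fin n → Pred n
joint G S x y z = S z ∧ adj G x z ∧ adj G y z

deg : ∀ {n} → Graph n → Pred n → Fin n → ℕ
deg G S x = # (nbrs G S x)

com : ∀ {n} → Graph n → Pred n → Fin n → Fin n → ℕ
com G S x y = # (joint G S x y)

module _ {n} (G : Graph n) (S : Pred n) {x z : Fin n} (h : nbrs G S x z ≡ true) where
  nbrs-∈ : S z ≡ true
  nbrs-∈ = ∧-fst h
  nbrs-adj : adj G x z ≡ true
  nbrs-adj = ∧-snd {S z} h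

module _ {n} (G : Graph n) (S : Pred n) {x y z : Fin n} (h : joint G S x y z ≡ true) where
  joint-∈ : S z ≡ true
  joint-∈ = ∧-fst h
  joint-fst : adj G x z ≡ true
  joint-fst = ∧-fst {adj G x z} (∧-snd {S z} h)
  joint-snd : adj G y z ≡ true
  joint-snd = ∧-snd {adj G x z} (∧-snd {S z} h)

module _ {n : ℕ} (G : Graph n) (S : Pred n) {L : ℕ} (free : CycleFree L G) where

  -- The threshold `L` guarantees a common neighbour outside any path with fewer than `L` vertices.
  Linked : Pred n → Set
  Linked q = ∀ x y → q x ≡ true → q y ≡ true → x ≢ y → L ≤ com G S x y

  -- Prolong the path by hops between unused vertices of q through common neighbours; the last hop
  -- returns to the start.
  zigzag : ∀ {q} → Linked q → L ≤ # q → ∀ j {l p} → Path G l p →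
           q (p 0) ≡ true → q (p l) ≡ true → p 0 ≢ p l → 2 * j + l + 2 ≡ L → ⊥
  -- The path has `l + 1` vertices, each hop adds two and the closing common neighbour one:
  -- `2 * j + l + 2` in all.
  zigzag {q} linked big zero {l} {p} path q₀ qₗ p₀≢pₗ len
    with fresh (suc l) p (joint G S (p 0) (p l))
           (≤-trans (≤-reflexive (trans (≡-sym (+-comm l 2)) len)) (linked _ _ q₀ qₗ p₀≢pₗ))
  ... | z , sz , z∉ = free (subst (ContainsCycle (adj G)) (trans (+-comm 2 l) len)
          (Path-close G (Path-◂ G path zp₀ (λ i i≤l → z∉ i (s≤s i≤l))) (joint-snd G S sz)))
    where
    zp₀ : adj G z (p 0) ≡ true
    zp₀ = trans (sym G z (p 0)) (joint-fst G S sz)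
  zigzag {q} linked big (suc j) {l} {p} path q₀ qₗ p₀≢pₗ len
    with fresh (suc l) p q (≤-trans (l+2≤L j l len) big)
    where
    l+2≤L : ∀ j l → 2 * suc j + l + 2 ≡ L → 2 + l ≤ L
    l+2≤L j l refl = ≤-trans (m≤n+m (2 + l) (2 * suc j)) (≤-reflexive (rearr j l))
      where
      rearr : ∀ j l → 2 * suc j + (2 + l) ≡ 2 * suc j + l + 2
      rearr = solve-∀
  ... | c , qc , c∉
    with fresh (2 + l) (c ◂ p) (joint G S (p 0) c)
           (≤-trans (l+3≤L j l len) (linked _ _ q₀ qc (λ eq → c∉ 0 (s≤s z≤n) (≡-sym eq))))
    where
    l+3≤L : ∀ j l → 2 * suc j + l + 2 ≡ L → 3 + l ≤ L
    l+3≤L j l refl = ≤-trans (m≤n+m (3 + l) (2 * j + 1)) (≤-reflexive (rearr j l))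
      where
      rearr : ∀ j l → 2 * j + 1 + (3 + l) ≡ 2 * suc j + l + 2
      rearr = solve-∀
  ... | z , sz , z∉ = zigzag linked big j
          (Path-◂ G (Path-◂ G path zp₀ (λ i i≤l → z∉ (suc i) (s≤s (s≤s i≤l)))) cz c∉zp)
          qc qₗ (c∉ l ≤-refl) (trans (rearr j l) len)
    where
    zp₀ : adj G z (p 0) ≡ true
    zp₀ = trans (sym G z (p 0)) (joint-fst G S sz)
    cz : adj G c z ≡ true
    cz = joint-snd G S sz
    c∉zp : ∀ i → i ≤ suc l → c ≢ (z ◂ p) i
    c∉zp zero    _         = λ eq → z∉ 0 (s≤s z≤n) (≡-sym eq)
    c∉zp (suc i) (s≤s i≤l) = c∉ i (s≤s i≤l)
    rearr : ∀ j l → 2 * j + suc (suc l) + 2 ≡ 2 * suc j + l + 2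
    rearr = solve-∀

-- Edge counts inside a vertex set

∑∑-distrib-+ : ∀ {m n} (f g : Fin m → Fin n → ℕ) →
  sum (λ x → sum (λ y → f x y + g x y)) ≡ sum (λ x → sum (f x)) + sum (λ x → sum (g x))
∑∑-distrib-+ {m} f g = trans (sum-cong-≗ {m} (λ x → ∑-distrib-+ (f x) (g x)))
                             (∑-distrib-+ (λ x → sum (f x)) (λ x → sum (g x)))

∑∑-cong : ∀ {m n} {f g : Fin m → Fin n → ℕ} → (∀ x y → f x y ≡ g x y) →
  sum (λ x → sum (f x)) ≡ sum (λ x → sum (g x))
∑∑-cong {m} {n} h = sum-cong-≗ {m} (λ x → sum-cong-≗ {n} (h x))

-- Ordered pairs, i.e. twice the number of edges inside S.
e₂ : ∀ {n} → Graph n → Pred n → ℕ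
e₂ G S = sum (λ x → sum (λ y → ⟦ S x ∧ S y ∧ adj G x y ⟧))

-- The ordered pairs that are lost have `x` as first entry (`B`) or as second entry (`C`), never
-- both, since `adj` is irreflexive.
e₂-∖ : ∀ {n} (G : Graph n) (S : Pred n) x → S x ≡ true →
       e₂ G S ≡ e₂ G (S ∖ x) + 2 * deg G S x
e₂-∖ {n} G S x sx = begin-equality
  e₂ G S
    ≡⟨ ∑∑-cong {n} {n} pointwise ⟩
  sum (λ y → sum (λ z → A y z + (B y z + C y z)))
    ≡⟨ ∑∑-distrib-+ A (λ y z → B y z + C y z) ⟩
  e₂ G (S ∖ x) + sum (λ y → sum (λ z → B y z + C y z))
    ≡⟨ cong (e₂ G (S ∖ x) +_) (∑∑-distrib-+ B C) ⟩
  e₂ G (S ∖ x) + (sum (λ y → sum (B y)) + sum (λ y → sum (C y)))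
    ≡⟨ cong₂ (λ s t → e₂ G (S ∖ x) + (s + t)) ∑∑B ∑∑C ⟩
  e₂ G (S ∖ x) + (deg G S x + deg G S x)
    ≡⟨ cong (λ s → e₂ G (S ∖ x) + (deg G S x + s)) (≡-sym (+-identityʳ _)) ⟩
  e₂ G (S ∖ x) + 2 * deg G S x ∎
  where
  open ≤-Reasoning
  N : Fin n → ℕ
  N y = ⟦ S y ∧ adj G x y ⟧
  A B C : Fin n → Fin n → ℕ
  A y z = ⟦ (S ∖ x) y ∧ (S ∖ x) z ∧ adj G y z ⟧
  B y z = ⟦ does (y ≟ x) ⟧ * N z
  C y z = ⟦ does (z ≟ x) ⟧ * N y
  pointwise : ∀ y z → ⟦ S y ∧ S z ∧ adj G y z ⟧ ≡ A y z + (B y z + C y z)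
  pointwise y z with y ≟ x | z ≟ x
  pointwise y z | yes refl | yes refl rewrite sx | irrefl G x = refl
  pointwise y z | yes refl | no _ rewrite sx = ≡-sym (trans (+-identityʳ _) (+-identityʳ _))
  pointwise y z | no _ | yes refl rewrite sx | sym G y x with S y
  ... | true  = ≡-sym (+-identityʳ _)
  ... | false = refl
  pointwise y z | no _ | no _ with S y | S z
  ... | true  | true  = ≡-sym (+-identityʳ _)
  ... | true  | false = refl
  ... | false | _     = refl
  ∑∑B : sum (λ y → sum (B y)) ≡ deg G S x
  ∑∑B = trans (sum-cong-≗ {n} (λ y → ≡-sym (*-distribˡ-sum ⟦ does (y ≟ x) ⟧ N)))
              (sum-at x (λ _ → deg G S x))
  ∑∑C : sum (λ y → sum (C y)) ≡ deg G S x
  ∑∑C = sum-cong-≗ {n} (λ y → sum-at x (λ _ → N y))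

deg+deg≤ : ∀ {n} (G : Graph n) S x y → deg G S x + deg G S y ≤ # S + com G S x y
deg+deg≤ G S x y = begin
  deg G S x + deg G S y
    ≡⟨ ≡-sym (∑-distrib-+ (λ z → ⟦ S z ∧ adj G x z ⟧) (λ z → ⟦ S z ∧ adj G y z ⟧)) ⟩
  sum (λ z → ⟦ S z ∧ adj G x z ⟧ + ⟦ S z ∧ adj G y z ⟧)
    ≤⟨ sum-mono (λ z → pointwise (S z) (adj G x z) (adj G y z)) ⟩
  sum (λ z → ⟦ S z ⟧ + ⟦ S z ∧ adj G x z ∧ adj G y z ⟧)
    ≡⟨ ∑-distrib-+ (λ z → ⟦ S z ⟧) (λ z → ⟦ S z ∧ adj G x z ∧ adj G y z ⟧) ⟩
  # S + com G S x y ∎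
  where
  open ≤-Reasoning
  pointwise : ∀ s a b → ⟦ s ∧ a ⟧ + ⟦ s ∧ b ⟧ ≤ ⟦ s ⟧ + ⟦ s ∧ a ∧ b ⟧
  pointwise false a     b     = z≤n
  pointwise true  true  b     = ≤-refl
  pointwise true  false true  = s≤s z≤n
  pointwise true  false false = z≤n

-- Bonferroni's inequality: a vertex of `S` in exactly m of the three neighbourhoods contributes m
-- on the left and 1 + m(m-1)/2 on the right.
deg+deg+deg≤ : ∀ {n} (G : Graph n) S x y z →
  deg G S x + deg G S y + deg G S z ≤ # S + (com G S x y + (com G S x z + com G S y z))
deg+deg+deg≤ {n} G S x y z = begin
  deg G S x + deg G S y + deg G S z
    ≡⟨ cong (_+ deg G S z) (≡-sym (∑-distrib-+ (D x) (D y))) ⟩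
  sum (λ v → D x v + D y v) + deg G S z
    ≡⟨ ≡-sym (∑-distrib-+ (λ v → D x v + D y v) (D z)) ⟩
  sum (λ v → D x v + D y v + D z v)
    ≤⟨ sum-mono (λ v → pointwise (S v) (adj G x v) (adj G y v) (adj G z v)) ⟩
  sum (λ v → ⟦ S v ⟧ + (C x y v + (C x z v + C y z v)))
    ≡⟨ ∑-distrib-+ (λ v → ⟦ S v ⟧) (λ v → C x y v + (C x z v + C y z v)) ⟩
  # S + sum (λ v → C x y v + (C x z v + C y z v))
    ≡⟨ cong (# S +_) (∑-distrib-+ (C x y) (λ v → C x z v + C y z v)) ⟩
  # S + (com G S x y + sum (λ v → C x z v + C y z v))
    ≡⟨ cong (λ s → # S + (com G S x y + s)) (∑-distrib-+ (C x z) (C y z)) ⟩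
  # S + (com G S x y + (com G S x z + com G S y z)) ∎
  where
  open ≤-Reasoning
  D : Fin n → Fin n → ℕ
  D x v = ⟦ S v ∧ adj G x v ⟧
  C : Fin n → Fin n → Fin n → ℕ
  C x y v = ⟦ S v ∧ adj G x v ∧ adj G y v ⟧
  pointwise : ∀ s a b c → ⟦ s ∧ a ⟧ + ⟦ s ∧ b ⟧ + ⟦ s ∧ c ⟧ ≤
                          ⟦ s ⟧ + (⟦ s ∧ a ∧ b ⟧ + (⟦ s ∧ a ∧ c ⟧ + ⟦ s ∧ b ∧ c ⟧))
  pointwise false a     b     c     = z≤n
  pointwise true  true  true  true  = s≤s (s≤s (s≤s z≤n))
  pointwise true  true  true  false = ≤-refl
  pointwise true  true  false true  = ≤-refl
  pointwise true  true  false false = ≤-refl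
  pointwise true  false true  true  = ≤-refl
  pointwise true  false true  false = ≤-refl
  pointwise true  false false true  = ≤-refl
  pointwise true  false false false = z≤n

com-comm : ∀ {n} (G : Graph n) S x y → com G S x y ≤ com G S y x
com-comm G S x y = #-mono (joint G S x y) (joint G S y x) λ z h →
  ∧-intro (joint-∈ G S h) (∧-intro (joint-snd G S h) (joint-fst G S h))

com≤deg : ∀ {n} (G : Graph n) S x y → com G S x y ≤ deg G S x
com≤deg G S x y = #-mono (joint G S x y) (nbrs G S x) λ z h →
  ∧-intro (joint-∈ G S h) (joint-fst G S h)

deg≤# : ∀ {n} (G : Graph n) S x → deg G S x ≤ # S
deg≤# G S x = #-mono (nbrs G S x) S λ z h → nbrs-∈ G S h

adjacent-≢ : ∀ {n} (G : Graph n) {x y} → adj G x y ≡ true → x ≢ y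
adjacent-≢ G {x} xy refl = true≢false xy (irrefl G x)

-- Linear arithmetic by certificate: `p ≤ q` is the sum of suitable multiples of the hypotheses, and
-- `z` collects the terms that cancel.
by-sum : ∀ {p q a b} z → p ≤ q → a + z ≡ p → q ≡ b + z → a ≤ b
by-sum {a = a} {b} z p≤q refl refl = +-cancelʳ-≤ z a b p≤q

-- In a minimal counterexample every degree exceeds half the order, so any two vertices have
-- many common neighbours and an edge closes up to a cycle of length 2k+1.
e₂≤ : ∀ {n} (G : Graph n) k → 1 ≤ k → CycleFree (2 * k + 1) G → ∀ s (S : Pred n) → # S ≡ s →
      2 * e₂ G S ≤ s * s + 2 * (2 * k + 1) * s
e₂≤ {n} G (suc k) _ free zero S #S = ≤-trans (≤-reflexive (cong (2 *_) e₂≡0)) z≤n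
  where
  S-empty : ∀ x → S x ≡ false
  S-empty x with S x in sx
  ... | false = refl
  ... | true  = ⊥-elim (n≮0 (≤-trans (∃⇒#-pos S x sx) (≤-reflexive #S)))
  e₂≡0 : e₂ G S ≡ 0
  e₂≡0 = trans (sum-cong-≗ {n} (λ x → #-none {n} (λ y → cong (λ b → b ∧ S y ∧ adj G x y) (S-empty x))))
               (sum-replicate-zero n)
e₂≤ {n} G (suc k) 1≤k free (suc s) S #S
  with Finₚ.any? (λ x → S x ≟ᵇ true ×-dec (2 * deg G S x <? suc s + L))
  where
  L = 2 * suc k + 1
... | yes (x , sx , small) = begin
  2 * e₂ G S                                     ≡⟨ cong (2 *_) (e₂-∖ G S x sx) ⟩
  2 * (e₂ G (S ∖ x) + 2 * deg G S x)             ≡⟨ *-distribˡ-+ 2 (e₂ G (S ∖ x)) _ ⟩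
  2 * e₂ G (S ∖ x) + 2 * (2 * deg G S x)         ≤⟨ +-mono-≤ (e₂≤ G (suc k) 1≤k free s (S ∖ x)
                                                      (suc-injective (trans (≡-sym (#-∖-∈ S x sx)) #S)))
                                                      (*-monoʳ-≤ 2 (≤-pred small)) ⟩
  s * s + 2 * L * s + 2 * (s + L)                ≤⟨ n≤1+n _ ⟩
  suc (s * s + 2 * L * s + 2 * (s + L))          ≡⟨ rearr s L ⟩
  suc s * suc s + 2 * L * suc s                  ∎
  where
  open ≤-Reasoning
  L = 2 * suc k + 1
  rearr : ∀ s L → suc (s * s + 2 * L * s + 2 * (s + L)) ≡ suc s * suc s + 2 * L * suc s
  rearr = solve-∀
... | no ¬small = ⊥-elim (
  let (x , sx)  = #-pos⇒∃ S (≤-trans (s≤s z≤n) (≤-reflexive (≡-sym #S)))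
      (y , sxy) = #-pos⇒∃ (nbrs G S x) (≤-trans (s≤s z≤n) (≤-trans (L≤com x x sx sx) (com≤deg G S x x)))
      xy        = nbrs-adj G S sxy
      yx        = trans (sym G y x) xy
  in zigzag G S free linked (≤-trans (L≤com x x sx sx) (≤-trans (com≤deg G S x x) (deg≤# G S x))) k
       (Path-◂ G (Path-∙ G x) yx (λ _ _ → adjacent-≢ G yx)) (nbrs-∈ G S sxy) sx (adjacent-≢ G yx) (len k))
  where
  L = 2 * suc k + 1
  len : ∀ k → 2 * k + 1 + 2 ≡ 2 * suc k + 1
  len = solve-∀
  large : ∀ x → S x ≡ true → suc s + L ≤ 2 * deg G S x
  large x sx = ≮⇒≥ (λ small → ¬small (x , sx , small))
  L≤com : ∀ x y → S x ≡ true → S y ≡ true → L ≤ com G S x y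
  L≤com x y sx sy = double-cancel (begin
    2 * (suc s + L)                      ≡⟨ cong (suc s + L +_) (+-identityʳ _) ⟩
    (suc s + L) + (suc s + L)            ≤⟨ +-mono-≤ (large x sx) (large y sy) ⟩
    2 * deg G S x + 2 * deg G S y        ≡⟨ ≡-sym (*-distribˡ-+ 2 (deg G S x) _) ⟩
    2 * (deg G S x + deg G S y)          ≤⟨ *-monoʳ-≤ 2 (deg+deg≤ G S x y) ⟩
    2 * (# S + com G S x y)              ≡⟨ cong (λ t → 2 * (t + com G S x y)) #S ⟩
    2 * (suc s + com G S x y)            ∎)
    where
    open ≤-Reasoning
    double-cancel : ∀ {a} → 2 * (suc s + L) ≤ 2 * (suc s + a) → L ≤ a
    double-cancel h = +-cancelˡ-≤ (suc s) _ _ (*-cancelˡ-≤ 2 h)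
  linked : Linked G S free S
  linked x y sx sy _ = L≤com x y sx sy

-- The bipartition of `S`

does-true : ∀ {P : Set} (d : Dec P) → P → does d ≡ true
does-true (yes _) _ = refl
does-true (no ¬p) p = ⊥-elim (¬p p)

does-false : ∀ {P : Set} (d : Dec P) → ¬ P → does d ≡ false
does-false (yes p) ¬p = ⊥-elim (¬p p)
does-false (no _)  _  = refl

true-does : ∀ {P : Set} (d : Dec P) → does d ≡ true → P
true-does (yes p) _ = p

false-does : ∀ {P : Set} (d : Dec P) → does d ≡ false → ¬ P
false-does (no ¬p) _ = ¬p

parity : ∀ i → ∃ λ a → i ≡ 2 * a ⊎ i ≡ suc (2 * a)
parity zero    = 0 , inj₁ refl
parity (suc i) with parity i
... | a , inj₁ refl = a , inj₂ refl
... | a , inj₂ refl = suc a , inj₁ (≡-sym (*-suc 2 a))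

-- An interior vertex cuts a path of length 2k into pieces of lengths `suc i` and `suc i′`, both odd
-- or both even. The half-lengths `a` and `b` trade places later: each is the number of hops that
-- closes the other piece.
interior-parity : ∀ i i′ k → suc i + suc i′ ≡ 2 * k →
  (∃ λ a → ∃ λ b → i ≡ 2 * a × i′ ≡ 2 * b × k ≡ 1 + (a + b)) ⊎
  (∃ λ a → ∃ λ b → i ≡ suc (2 * a) × i′ ≡ suc (2 * b) × k ≡ 2 + (a + b))
interior-parity i i′ k eq with parity i | parity i′
... | a , inj₁ refl | b , inj₁ refl =
  inj₁ (a , b , refl , refl , *-cancelˡ-≡ k _ 2 (trans (≡-sym eq) (rearr a b)))
  where
  rearr : ∀ a b → suc (2 * a) + suc (2 * b) ≡ 2 * (1 + (a + b))
  rearr = solve-∀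
... | a , inj₂ refl | b , inj₂ refl =
  inj₂ (a , b , refl , refl , *-cancelˡ-≡ k _ 2 (trans (≡-sym eq) (rearr a b)))
  where
  rearr : ∀ a b → suc (suc (2 * a)) + suc (suc (2 * b)) ≡ 2 * (2 + (a + b))
  rearr = solve-∀
... | a , inj₁ refl | b , inj₂ refl = ⊥-elim (even≢odd k (1 + (a + b)) (trans (≡-sym eq) (rearr a b)))
  where
  rearr : ∀ a b → suc (2 * a) + suc (suc (2 * b)) ≡ suc (2 * (1 + (a + b)))
  rearr = solve-∀
... | a , inj₂ refl | b , inj₁ refl = ⊥-elim (even≢odd k (1 + (a + b)) (trans (≡-sym eq) (rearr a b)))
  where
  rearr : ∀ a b → suc (suc (2 * a)) + suc (2 * b) ≡ suc (2 * (1 + (a + b)))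
  rearr = solve-∀

record Bipartition {n} (G : Graph n) (S X Y : Pred n) : Set where
  field
    cover : ∀ z → S z ≡ true → X z ≡ true ⊎ Y z ≡ true
    X⊆S   : ∀ z → X z ≡ true → S z ≡ true
    Y⊆S   : ∀ z → Y z ≡ true → S z ≡ true
    disj  : ∀ z → X z ≡ true → Y z ≡ true → ⊥
    indX  : ∀ x y → X x ≡ true → X y ≡ true → adj G x y ≡ true → ⊥
    indY  : ∀ x y → Y x ≡ true → Y y ≡ true → adj G x y ≡ true → ⊥
    x₀    : ∃ λ x → X x ≡ true
    y₀    : ∃ λ y → Y y ≡ true
open Bipartition

swap : ∀ {n} {G : Graph n} {S X Y} → Bipartition G S X Y → Bipartition G S Y X
swap b = record
  { cover = λ z sz → case cover b z sz of λ where (inj₁ x) → inj₂ x ; (inj₂ y) → inj₁ y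
  ; X⊆S = Y⊆S b ; Y⊆S = X⊆S b ; disj = λ z yz xz → disj b z xz yz
  ; indX = indY b ; indY = indX b ; x₀ = y₀ b ; y₀ = x₀ b }

-- The last hypothesis says that the neighbourhoods in S are so large that among any three of
-- them two have a large intersection.
module _ {n : ℕ} (G : Graph n) (S : Pred n) (j : ℕ)
  (free : CycleFree (2 * (2 + j) + 1) G)
  (triple : ∀ x y z → S x ≡ true → S y ≡ true → S z ≡ true →
            com G S x y ≤ (2 * (2 + j) + 1) * (2 * (2 + j) + 1) →
            com G S x z ≤ (2 * (2 + j) + 1) * (2 * (2 + j) + 1) →
            com G S y z ≤ (2 * (2 + j) + 1) * (2 * (2 + j) + 1) → ⊥)
  where

  private
    k L : ℕ
    k = 2 + j
    L = 2 * k + 1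

    infix 4 _⊆_
    _⊆_ : Pred n → Pred n → Set
    p ⊆ q = ∀ z → p z ≡ true → q z ≡ true

    L≤L² : L ≤ L * L
    L≤L² = m≤m*n L L

    0<L : 0 < L
    0<L = ≤-trans (s≤s z≤n) (m≤n+m 1 (2 * k))

  -- The common neighbours of `x` with itself are its neighbours, so `triple` at `x`, `x`, `x` gives
  -- a lower bound on the degree.
  L≤com-self : ∀ x → S x ≡ true → L ≤ com G S x x
  L≤com-self x sx = ≮⇒≥ small
    where
    small : ¬ com G S x x < L
    small lt = let le = ≤-trans (<⇒≤ lt) L≤L² in triple x x x sx sx sx le le le

  L≤deg : ∀ x → S x ≡ true → L ≤ deg G S x
  L≤deg x sx = ≤-trans (L≤com-self x sx) (com≤deg G S x x)

  third : ∀ x y z → S x ≡ true → S y ≡ true → S z ≡ true →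
          com G S x z ≤ L * L → com G S y z ≤ L * L → L ≤ com G S x y
  third x y z sx sy sz xz yz =
    ≮⇒≥ (λ lt → triple x y z sx sy sz (≤-trans (<⇒≤ lt) L≤L²) xz yz)

  -- Neighbours `c` of `x` and `c′` of `x′`, both chosen in `q`, give the path `c`, `x`, `x′`, `c′`
  -- of length 3. With `j` hops inside `q` it closes up to a cycle of length 2j + 5 = `L`.
  fan : ∀ {q} → Linked G S free q → L ≤ # q → ∀ x x′ → adj G x x′ ≡ true →
        L ≤ deg G q x → L ≤ deg G q x′ → ⊥
  fan {q} linked big x x′ xx′ dx dx′ =
    let 2<L              = ≤-trans (m≤m+n 3 (2 * j + 2)) (≤-reflexive (3+ j))
        (c  , qc  , c∉)  = fresh 1 (λ _ → x′) (nbrs G q x) (≤-trans (≤-trans (s≤s (s≤s z≤n)) 2<L) dx)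
        (c′ , qc′ , c′∉) = fresh 2 (x ◂ λ _ → c) (nbrs G q x′) (≤-trans 2<L dx′)
        x′c′ = nbrs-adj G q qc′
        xc   = nbrs-adj G q qc
        cx   = trans (sym G c x) xc
    in zigzag G S free linked big j
         (Path-◂ G (Path-◂ G (Path-◂ G (Path-∙ G c′) x′c′ (λ _ _ → adjacent-≢ G x′c′)) xx′
           (λ { zero _ → adjacent-≢ G xx′ ; (suc i) _ → λ eq → c′∉ 0 (s≤s z≤n) (≡-sym eq) })) cx
           (λ { zero _ → adjacent-≢ G cx
              ; (suc zero) _ → c∉ 0 (s≤s z≤n)
              ; (suc (suc i)) _ → λ eq → c′∉ 1 (s≤s (s≤s z≤n)) (≡-sym eq) }))
         (nbrs-∈ G q qc) (nbrs-∈ G q qc′) (λ eq → c′∉ 1 (s≤s (s≤s z≤n)) (≡-sym eq)) (len j)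
    where
    3+ : ∀ j → 3 + (2 * j + 2) ≡ 2 * (2 + j) + 1
    3+ = solve-∀
    len : ∀ j → 2 * j + 3 + 2 ≡ 2 * (2 + j) + 1
    len = solve-∀

  -- By `triple`, no three vertices of `S` are pairwise badly linked. Fix `c` in `q`: vertices that
  -- share few neighbours with `c` are thus linked among themselves, so `far` will do if it has `L`
  -- elements. Otherwise almost everything is in `near`, and `c` can be added to a linked set found
  -- there by recursion.
  ramsey : ∀ m (q : Pred n) → q ⊆ S → m * L ≤ # q →
           ∃ λ r → r ⊆ q × Linked G S free r × (m ≤ # r ⊎ L ≤ # r)
  ramsey zero    q q⊆S _   = (λ _ → false) , (λ _ ()) , (λ _ _ ()) , inj₁ z≤n
  ramsey (suc m) q q⊆S big with #-pos⇒∃ q (≤-trans 0<L (≤-trans (m≤m+n L (m * L)) big))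
  ... | c , qc = choose (L ≤? # far)
    where
    near far : Pred n
    near z = (q ∖ c) z ∧ does (L ≤? com G S c z)
    far  z = (q ∖ c) z ∧ not (does (L ≤? com G S c z))
    split : # (q ∖ c) ≡ # near + # far
    split = trans (sum-cong-≗ {n} (λ z → pointwise ((q ∖ c) z) (does (L ≤? com G S c z))))
                  (∑-distrib-+ (λ z → ⟦ near z ⟧) (λ z → ⟦ far z ⟧))
      where
      pointwise : ∀ a b → ⟦ a ⟧ ≡ ⟦ a ∧ b ⟧ + ⟦ a ∧ not b ⟧
      pointwise false b     = refl
      pointwise true  false = refl
      pointwise true  true  = refl
    near⊆q : near ⊆ q
    near⊆q z h = ∧-fst (∧-fst {(q ∖ c) z} h)
    far⊆q : far ⊆ q
    far⊆q z h = ∧-fst (∧-fst {(q ∖ c) z} h)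
    far-com : ∀ z → far z ≡ true → com G S c z < L
    far-com z h = ≰⇒> (false-does (L ≤? com G S c z) (not-true (∧-snd {(q ∖ c) z} h)))
    far-linked : Linked G S free far
    far-linked x y fx fy _ = third x y c (q⊆S x (far⊆q x fx)) (q⊆S y (far⊆q y fy)) (q⊆S c qc)
      (small x fx) (small y fy)
      where
      small : ∀ x → far x ≡ true → com G S x c ≤ L * L
      small x fx = ≤-trans (com-comm G S x c) (≤-trans (<⇒≤ (far-com x fx)) L≤L²)
    choose : Dec (L ≤ # far) → ∃ λ r → r ⊆ q × Linked G S free r × (suc m ≤ # r ⊎ L ≤ # r)
    choose (yes h) = far , far⊆q , far-linked , inj₂ h
    choose (no ¬h) with ramsey m near (λ z h → q⊆S z (near⊆q z h)) near-big
      where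
      near-big : m * L ≤ # near
      -- Only `c` and at most `L - 1` elements of `far` are lost, together at most `L`.
      near-big = by-sum L (≤-trans big (≤-trans (≤-reflexive (#-∖-∈ q c qc))
                   (≤-trans (≤-reflexive (trans (cong suc split) (≡-sym (+-suc (# near) (# far)))))
                     (+-monoʳ-≤ (# near) (≰⇒> ¬h))))) (+-comm (m * L) L) refl
    ... | r , r⊆near , r-linked , inj₂ h = r , (λ z h → near⊆q z (r⊆near z h)) , r-linked , inj₂ h
    ... | r , r⊆near , r-linked , inj₁ h = r⁺ , r⁺⊆q , r⁺-linked , inj₁ r⁺-big
      where
      r⁺ : Pred n
      r⁺ z = does (z ≟ c) ∨ r z
      r⁺-elim : ∀ z → r⁺ z ≡ true → z ≡ c ⊎ r z ≡ true
      r⁺-elim z h with z ≟ c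
      ... | yes eq = inj₁ eq
      ... | no _   = inj₂ h
      r⁺⊆q : r⁺ ⊆ q
      r⁺⊆q z h with r⁺-elim z h
      ... | inj₁ refl = qc
      ... | inj₂ rz   = near⊆q z (r⊆near z rz)
      c-near : ∀ z → r z ≡ true → L ≤ com G S c z
      c-near z rz = true-does (L ≤? com G S c z) (∧-snd {(q ∖ c) z} (r⊆near z rz))
      r⁺-linked : Linked G S free r⁺
      r⁺-linked x y hx hy x≢y with r⁺-elim x hx | r⁺-elim y hy
      ... | inj₁ refl | inj₁ refl = ⊥-elim (x≢y refl)
      ... | inj₁ refl | inj₂ ry   = c-near y ry
      ... | inj₂ rx   | inj₁ refl = ≤-trans (c-near x rx) (com-comm G S y x)
      ... | inj₂ rx   | inj₂ ry   = r-linked x y rx ry x≢y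
      r⊆r⁺∖c : r ⊆ r⁺ ∖ c
      r⊆r⁺∖c z rz with z ≟ c
      ... | no _     = ∧-intro rz refl
      ... | yes refl = ⊥-elim (∖-≢ {p = q} {c} {c} (∧-fst {(q ∖ c) c} (r⊆near c rz)) refl)
      r⁺-big : suc m ≤ # r⁺
      r⁺-big = ≤-trans (s≤s (≤-trans h (#-mono r (r⁺ ∖ c) r⊆r⁺∖c)))
        (≤-reflexive (≡-sym (#-∖-∈ r⁺ c (cong (_∨ r c) (≟-refl c)))))

  -- Among `L * L` common neighbours `ramsey` finds `L` that are linked. All of them are adjacent to
  -- both ends of the edge, so `fan` applies.
  adjacent-com : ∀ x y → S x ≡ true → S y ≡ true → adj G x y ≡ true → com G S x y < L * L
  adjacent-com x y sx sy xy = ≰⇒> λ big →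
    let (r , r⊆ , linked , size) = ramsey L (joint G S x y) (λ z h → joint-∈ G S h) big
        L≤#r = case size of λ where (inj₁ h) → h ; (inj₂ h) → h
    in fan linked L≤#r x y xy
         (≤-trans L≤#r (#-mono r (nbrs G r x) (λ z h → ∧-intro h (joint-fst G S (r⊆ z h)))))
         (≤-trans L≤#r (#-mono r (nbrs G r y) (λ z h → ∧-intro h (joint-snd G S (r⊆ z h)))))

  -- By `adjacent-com` a neighbour of `v` shares few vertices with `v`, so by `third` any two
  -- neighbours of `v` share many. The neighbourhood of `v` is therefore a linked set, to which
  -- `fan` applies with the edge from `x` to `x′`.
  independent : ∀ v x x′ → S v ≡ true → adj G x x′ ≡ true →
                L ≤ com G S x v → L ≤ com G S x′ v → ⊥
  independent v x x′ sv xx′ cx cx′ =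
    fan linked (L≤deg v sv) x x′ xx′ (≤-trans cx (flip x)) (≤-trans cx′ (flip x′))
    where
    linked : Linked G S free (nbrs G S v)
    linked c c′ h h′ _ = third c c′ v (nbrs-∈ G S h) (nbrs-∈ G S h′) sv (small c h) (small c′ h′)
      where
      small : ∀ c → nbrs G S v c ≡ true → com G S c v ≤ L * L
      small c h = <⇒≤ (adjacent-com c v (nbrs-∈ G S h) sv (trans (sym G c v) (nbrs-adj G S h)))
    flip : ∀ x → com G S x v ≤ deg G (nbrs G S v) x
    flip x = #-mono (joint G S x v) (nbrs G (nbrs G S v) x) λ z h →
      ∧-intro (∧-intro (joint-∈ G S h) (joint-snd G S h)) (joint-fst G S h)

  -- Take an edge from `u` to `v` in `S`, and let `X` consist of the vertices with at least `L`
  -- common neighbours with `v`. As `u` and `v` share few neighbours, `third` gives every other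
  -- vertex at least `L` common neighbours with `u`. Now `independent`, at `v` and at `u`, excludes
  -- edges inside either part.
  bipartite : ∀ u → S u ≡ true → ∃ λ X → ∃ λ Y → Bipartition G S X Y
  bipartite u su = X , Y , record
    { cover = cover′
    ; X⊆S = λ z h → ∧-fst h
    ; Y⊆S = λ z h → ∧-fst h
    ; disj = λ z hx hy → true≢false (∧-snd {S z} hx) (not-true (∧-snd {S z} hy))
    ; indX = λ x y hx hy xy → independent v x y sv xy (X-com x hx) (X-com y hy)
    ; indY = λ x y hx hy xy → independent u x y su xy (Y-com x hx) (Y-com y hy)
    ; x₀ = v , v∈X
    ; y₀ = u , u∈Y (cover′ u su)
    }
    where
    v-nbr : ∃ λ v → nbrs G S u v ≡ true
    v-nbr = #-pos⇒∃ (nbrs G S u) (≤-trans 0<L (L≤deg u su))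
    v : Fin n
    v = proj₁ v-nbr
    sv : S v ≡ true
    sv = nbrs-∈ G S (proj₂ v-nbr)
    uv : adj G u v ≡ true
    uv = nbrs-adj G S (proj₂ v-nbr)
    X Y : Pred n
    X z = S z ∧ does (L ≤? com G S z v)
    Y z = S z ∧ not (does (L ≤? com G S z v))
    X-com : ∀ x → X x ≡ true → L ≤ com G S x v
    X-com x h = true-does (L ≤? com G S x v) (∧-snd {S x} h)
    Y-com : ∀ x → Y x ≡ true → L ≤ com G S x u
    Y-com x h = third x u v (∧-fst h) su sv
      (≤-trans (<⇒≤ (≰⇒> (false-does (L ≤? com G S x v) (not-true (∧-snd {S x} h))))) L≤L²)
      (<⇒≤ (adjacent-com u v su sv uv))
    cover′ : ∀ z → S z ≡ true → X z ≡ true ⊎ Y z ≡ true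
    cover′ z sz with does (L ≤? com G S z v)
    ... | true  = inj₁ (∧-intro sz refl)
    ... | false = inj₂ (∧-intro sz refl)
    v∈X : X v ≡ true
    v∈X = ∧-intro sv (does-true (L ≤? com G S v v) (L≤com-self v sv))
    u∈Y : X u ≡ true ⊎ Y u ≡ true → Y u ≡ true
    u∈Y (inj₁ u∈X) = ⊥-elim (independent v u v sv uv (X-com u u∈X) (X-com v v∈X))
    u∈Y (inj₂ u∈Y) = u∈Y


  -- Paths with ends in the bipartition

  module _ {X Y : Pred n} (B : Bipartition G S X Y) where

    -- Vertices on opposite sides have no common neighbour in `S`, as it would be adjacent to a
    -- vertex of its own side. Hence any vertex of `Y` can serve as the third vertex in `third`.
    linkedX : Linked G S free X
    linkedX x x′ hx hx′ _ =
      let (y , hy) = y₀ B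
      in third x x′ y (X⊆S B x hx) (X⊆S B x′ hx′) (Y⊆S B y hy) (≤-trans (≤-reflexive (apart x y hx hy)) z≤n)
           (≤-trans (≤-reflexive (apart x′ y hx′ hy)) z≤n)
      where
      apart : ∀ x y → X x ≡ true → Y y ≡ true → com G S x y ≡ 0
      apart x y hx hy = #-none {n} none
        where
        none : ∀ z → joint G S x y z ≡ false
        none z with joint G S x y z in h
        ... | false = refl
        ... | true with cover B z (joint-∈ G S h)
        ...   | inj₁ hz = ⊥-elim (indX B x z hx hz (joint-fst G S h))
        ...   | inj₂ hz = ⊥-elim (indY B y z hy hz (joint-snd G S h))

    nbrs⊆X : ∀ y → Y y ≡ true → ∀ z → nbrs G S y z ≡ true → X z ≡ true
    nbrs⊆X y hy z h with cover B z (nbrs-∈ G S h)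
    ... | inj₁ hz = hz
    ... | inj₂ hz = ⊥-elim (indY B y z hy hz (nbrs-adj G S h))

    deg≤#X : ∀ y → Y y ≡ true → deg G S y ≤ # X
    deg≤#X y hy = #-mono (nbrs G S y) X (nbrs⊆X y hy)

    L≤#X : L ≤ # X
    L≤#X = let (y , hy) = y₀ B in ≤-trans (L≤deg y (Y⊆S B y hy)) (deg≤#X y hy)

    same-side : ∀ m {l p} → Path G l p → X (p 0) ≡ true → X (p l) ≡ true → p 0 ≢ p l →
                2 * m + l + 2 ≡ L → ⊥
    same-side m = zigzag G S free linkedX L≤#X m

    opposite-sides : ∀ m {l p} → Path G l p → Y (p 0) ≡ true → X (p l) ≡ true →
                     2 * m + l + 3 ≡ L → ⊥
    opposite-sides m {l} {p} path h₀ hₗ len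
      with fresh (suc l) p (nbrs G S (p 0))
             (≤-trans (l+2≤L m l len) (L≤deg (p 0) (Y⊆S B (p 0) h₀)))
      where
      l+2≤L : ∀ m l → 2 * m + l + 3 ≡ L → 2 + l ≤ L
      l+2≤L m l eq = ≤-trans (m≤n+m (2 + l) (2 * m + 1)) (≤-reflexive (trans (rearr m l) eq))
        where
        rearr : ∀ m l → 2 * m + 1 + (2 + l) ≡ 2 * m + l + 3
        rearr = solve-∀
    ... | z , hz , z∉ =
      same-side m (Path-◂ G path (trans (sym G z (p 0)) (nbrs-adj G S hz)) (λ i i≤l → z∉ i (s≤s i≤l)))
        (nbrs⊆X (p 0) h₀ z hz) hₗ (z∉ l ≤-refl) (trans (rearr m l) len)
      where
      rearr : ∀ m l → 2 * m + suc l + 2 ≡ 2 * m + l + 3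
      rearr = solve-∀

  -- A vertex of S in the interior would cut off a subpath whose parity is wrong for its ends, and
  -- a path alternating between X and Y would close that subpath up to a cycle of length 2k+1.
  interior∉S : ∀ {X Y} → Bipartition G S X Y → ∀ {p} → Path G (2 * k) p →
               Y (p 0) ≡ true → X (p (2 * k)) ≡ true →
               ∀ i i′ → suc i + suc i′ ≡ 2 * k → S (p (suc i)) ≡ true → ⊥
  interior∉S {X} {Y} B {p} path h₀ hₗ i i′ eq hs =
    cases (cover B (p (suc i)) hs) (interior-parity i i′ k eq)
    where
    prefix : Path G (suc i) p
    prefix = Path-prefix G path (≤-trans (m≤m+n (suc i) (suc i′)) (≤-reflexive eq))
    q : ℕ → Fin n
    q t = p (suc i + t)
    suffix : Path G (suc i′) q
    suffix = Path-suffix G (suc i) (subst (λ l → Path G l p) (≡-sym eq) path)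
    q₀ : ∀ {Z : Pred n} → Z (p (suc i)) ≡ true → Z (q 0) ≡ true
    q₀ {Z} h = trans (cong (Z ∘ p ∘ suc) (+-identityʳ i)) h
    qₗ : X (q (suc i′)) ≡ true
    qₗ = trans (cong (X ∘ p) eq) hₗ
    cases : X (p (suc i)) ≡ true ⊎ Y (p (suc i)) ≡ true →
            (∃ λ a → ∃ λ b → i ≡ 2 * a × i′ ≡ 2 * b × k ≡ 1 + (a + b)) ⊎
            (∃ λ a → ∃ λ b → i ≡ suc (2 * a) × i′ ≡ suc (2 * b) × k ≡ 2 + (a + b)) → ⊥
    -- In the first two cases both pieces are odd, and the one with both ends on the same side is
    -- closed. In the last two both are even, and the one with ends on opposite sides is closed.
    cases (inj₁ hx) (inj₁ (a , b , refl , refl , k≡)) =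
      same-side B a suffix (q₀ {X} hx) qₗ (proj₂ suffix 0 (suc i′) (s≤s z≤n) ≤-refl)
        (trans (rearr a b) (cong (λ k → 2 * k + 1) (≡-sym k≡)))
      where
      rearr : ∀ a b → 2 * a + suc (2 * b) + 2 ≡ 2 * (1 + (a + b)) + 1
      rearr = solve-∀
    cases (inj₂ hy) (inj₁ (a , b , refl , refl , k≡)) =
      same-side (swap B) b prefix h₀ hy (proj₂ prefix 0 (suc i) (s≤s z≤n) ≤-refl)
        (trans (rearr a b) (cong (λ k → 2 * k + 1) (≡-sym k≡)))
      where
      rearr : ∀ a b → 2 * b + suc (2 * a) + 2 ≡ 2 * (1 + (a + b)) + 1
      rearr = solve-∀
    cases (inj₁ hx) (inj₂ (a , b , refl , refl , k≡)) =
      opposite-sides B b prefix h₀ hx (trans (rearr a b) (cong (λ k → 2 * k + 1) (≡-sym k≡)))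
      where
      rearr : ∀ a b → 2 * b + suc (suc (2 * a)) + 3 ≡ 2 * (2 + (a + b)) + 1
      rearr = solve-∀
    cases (inj₂ hy) (inj₂ (a , b , refl , refl , k≡)) =
      opposite-sides B a suffix (q₀ {Y} hy) qₗ (trans (rearr a b) (cong (λ k → 2 * k + 1) (≡-sym k≡)))
      where
      rearr : ∀ a b → 2 * a + suc (suc (2 * b)) + 3 ≡ 2 * (2 + (a + b)) + 1
      rearr = solve-∀

  -- v is the vertex next to y on the path of length 2k; if x were adjacent to another neighbour
  -- y′ ∈ Y of v, replacing y by y′ on this path would give a cycle.
  blocker : ∀ {X Y} → Bipartition G S X Y → ∀ {p} → Path G (2 * k) p →
            Y (p 0) ≡ true → X (p (2 * k)) ≡ true →
            ∃ λ v → S v ≡ false × adj G v (p 0) ≡ true ×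
              (∀ y′ → Y y′ ≡ true → adj G v y′ ≡ true → adj G (p (2 * k)) y′ ≡ false)
  blocker {X} {Y} B {p} path h₀ hₗ = p 1 , outside , trans (sym G (p 1) (p 0)) (proj₁ path 0 (s≤s z≤n)) , none
    where
    interior : ∀ i → 0 < i → i < 2 * k → S (p i) ≡ false
    interior (suc i) _ i<2k with S (p (suc i)) in hs | m≤n⇒∃[o]m+o≡n i<2k
    ... | false | _ = refl
    ... | true  | i′ , eq = ⊥-elim (interior∉S B path h₀ hₗ i i′ (trans (+-suc (suc i) i′) eq) hs)
    outside : S (p 1) ≡ false
    outside = interior 1 (s≤s z≤n) (*-monoʳ-≤ 2 (s≤s (z≤n {suc j})))
    none : ∀ y′ → Y y′ ≡ true → adj G (p 1) y′ ≡ true → adj G (p (2 * k)) y′ ≡ false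
    none y′ hy′ vy′ with adj G (p (2 * k)) y′ in xy′
    ... | false = refl
    ... | true  = ⊥-elim (free (subst (ContainsCycle (adj G)) (≡-sym (+-comm (2 * k) 1))
                    (Path-close G cycle xy′)))
      where
      -- The bound `suc (j + 1 * k)` is 2k - 1 in the form to which `2 * k` unfolds. An interior
      -- vertex is avoided because it lies outside `S`, the far end because it lies in `X`.
      y′∉ : ∀ i → i ≤ suc (j + 1 * k) → y′ ≢ p (suc i)
      y′∉ i i≤ refl with m≤n⇒m<n∨m≡n i≤
      ... | inj₁ i<   = true≢false (Y⊆S B y′ hy′) (interior (suc i) (s≤s z≤n) (s≤s i<))
      ... | inj₂ refl = disj B y′ hₗ hy′
      cycle : Path G (2 * k) (y′ ◂ (p ∘ suc))
      cycle = Path-◂ G (Path-suffix G 1 path) (trans (sym G y′ (p 1)) vy′) y′∉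

-- From maximality to paths of length 2k

Path-reverse : ∀ {n} (G : Graph n) {l p} → Path G l p → Path G l (λ i → p (l ∸ i))
Path-reverse G {l} {p} (edge , inj) = edge′ , inj′
  where
  edge′ : ∀ i → i < l → adj G (p (l ∸ i)) (p (l ∸ suc i)) ≡ true
  edge′ i i<l = trans (sym G (p (l ∸ i)) (p (l ∸ suc i)))
    (subst (λ t → adj G (p (l ∸ suc i)) (p t) ≡ true) (≡-sym (+-∸-assoc 1 i<l))
      (edge (l ∸ suc i) (≤-trans (≤-reflexive (≡-sym (+-∸-assoc 1 i<l))) (m∸n≤m l i))))
  inj′ : ∀ i j → i < j → j ≤ l → p (l ∸ i) ≢ p (l ∸ j)
  inj′ i j i<j j≤l eq = inj (l ∸ j) (l ∸ i) (∸-monoʳ-< i<j j≤l) (m∸n≤m l i) (≡-sym eq)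

Cycle : ∀ {n} → (Fin n → Fin n → Bool) → ℕ → (ℕ → Fin n) → Set
Cycle E m p = (∀ i → i < m → E (p i) (p (suc i)) ≡ true)
            × E (p m) (p 0) ≡ true
            × (∀ i j → i < j → j ≤ m → p i ≢ p j)

ContainsCycle⇒Cycle : ∀ {n} (E : Fin n → Fin n → Bool) m → ContainsCycle E (suc m) → ∃ (Cycle E m)
ContainsCycle⇒Cycle {n} E m (f , injective , edge , closing) = p , edge′ , closing′ , inj
  where
  -- Indices beyond `m` are sent to `m`; `Cycle` looks only at those up to `m`.
  clamp : ℕ → Fin (suc m)
  clamp i = fromℕ< (s≤s (m⊓n≤n i m))
  toℕ-clamp : ∀ {i} → i ≤ m → toℕ (clamp i) ≡ i
  toℕ-clamp i≤m = trans (Finₚ.toℕ-fromℕ< _) (m≤n⇒m⊓n≡m i≤m)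
  p : ℕ → Fin n
  p = f ∘ clamp
  edge′ : ∀ i → i < m → E (p i) (p (suc i)) ≡ true
  edge′ i i<m = subst₂ (λ a b → E (f a) (f b) ≡ true)
    (Finₚ.toℕ-injective (trans (Finₚ.toℕ-inject₁ i′) (trans toℕ-i′ (≡-sym (toℕ-clamp (<⇒≤ i<m))))))
    (Finₚ.toℕ-injective (trans (cong suc toℕ-i′) (≡-sym (toℕ-clamp i<m))))
    (edge i′)
    where
    i′ : Fin m
    i′ = fromℕ< i<m
    toℕ-i′ : toℕ i′ ≡ i
    toℕ-i′ = Finₚ.toℕ-fromℕ< i<m
  closing′ : E (p m) (p 0) ≡ true
  closing′ = subst₂ (λ a b → E (f a) (f b) ≡ true)
    (Finₚ.toℕ-injective (trans (Finₚ.toℕ-fromℕ m) (≡-sym (toℕ-clamp ≤-refl))))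
    (Finₚ.toℕ-injective (≡-sym (toℕ-clamp {0} z≤n)))
    closing
  inj : ∀ i j → i < j → j ≤ m → p i ≢ p j
  inj i j i<j j≤m eq = <⇒≢ i<j (trans (≡-sym (toℕ-clamp (≤-trans (<⇒≤ i<j) j≤m)))
                         (trans (cong toℕ (injective eq)) (toℕ-clamp j≤m)))

rotate : ∀ {A : Set} → ℕ → (ℕ → A) → ℕ → A
rotate m p i = if does (i <? m) then p (suc i) else p 0

rotate-< : ∀ {A : Set} {m} (p : ℕ → A) {i} → i < m → rotate m p i ≡ p (suc i)
rotate-< {m = m} p {i} i<m rewrite does-true (i <? m) i<m = refl

rotate-m : ∀ {A : Set} m (p : ℕ → A) → rotate m p m ≡ p 0
rotate-m m p rewrite does-false (m <? m) (n≮n m) = refl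

Cycle-rotate : ∀ {n} {E : Fin n → Fin n → Bool} {m p} → 0 < m → Cycle E m p → Cycle E m (rotate m p)
Cycle-rotate {n} {E} {m} {p} 0<m (edge , closing , inj) = edge′ , closing′ , inj′
  where
  edge′ : ∀ i → i < m → E (rotate m p i) (rotate m p (suc i)) ≡ true
  edge′ i i<m with m≤n⇒m<n∨m≡n i<m
  ... | inj₁ 1+i<m rewrite rotate-< p i<m | rotate-< p 1+i<m = edge (suc i) 1+i<m
  ... | inj₂ refl  rewrite rotate-< p i<m | rotate-m (suc i) p = closing
  closing′ : E (rotate m p m) (rotate m p 0) ≡ true
  closing′ rewrite rotate-m m p | rotate-< p 0<m = edge 0 0<m
  inj′ : ∀ i j → i < j → j ≤ m → rotate m p i ≢ rotate m p j
  inj′ i j i<j j≤m eq with m≤n⇒m<n∨m≡n j≤m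
  ... | inj₁ j<m  rewrite rotate-< p (<-trans i<j j<m) | rotate-< p j<m = inj (suc i) (suc j) (s≤s i<j) j<m eq
  ... | inj₂ refl rewrite rotate-< p i<j | rotate-m m p = inj 0 (suc i) (s≤s z≤n) i<j (≡-sym eq)

-- If a cycle of E uses a pair outside F, it can be rotated so that this pair closes it.
Cycle-realign : ∀ {n} (E F : Fin n → Fin n → Bool) {m} i p → i < m → Cycle E m p →
                F (p i) (p (suc i)) ≡ false → ∃ λ q → Cycle E m q × F (q m) (q 0) ≡ false
Cycle-realign E F {m} zero p 0<m cyc ¬F = rotate m p , Cycle-rotate {E = E} 0<m cyc , ¬F′
  where
  ¬F′ : F (rotate m p m) (rotate m p 0) ≡ false
  ¬F′ rewrite rotate-m m p | rotate-< p 0<m = ¬F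
Cycle-realign E F {m} (suc i) p 1+i<m cyc ¬F =
  Cycle-realign E F i (rotate m p) (<⇒≤ 1+i<m) (Cycle-rotate {E = E} (≤-trans (s≤s z≤n) 1+i<m) cyc) ¬F′
  where
  ¬F′ : F (rotate m p i) (rotate m p (suc i)) ≡ false
  ¬F′ rewrite rotate-< p (<⇒≤ 1+i<m) | rotate-< p 1+i<m = ¬F

module _ {n} (G : Graph n) (u v : Fin n) where

  addEdge-elim : ∀ x y → addEdge G u v x y ≡ true →
                 adj G x y ≡ true ⊎ (x ≡ u × y ≡ v) ⊎ (x ≡ v × y ≡ u)
  addEdge-elim x y h with adj G x y | x ≟ u | y ≟ v | x ≟ v | y ≟ u
  ... | true  | _      | _      | _      | _      = inj₁ refl
  ... | false | yes xu | yes yv | _      | _      = inj₂ (inj₁ (xu , yv))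
  ... | false | _      | _      | yes xv | yes yu = inj₂ (inj₂ (xv , yu))
  addEdge-elim x y () | false | yes _ | no _ | yes _ | no _
  addEdge-elim x y () | false | yes _ | no _ | no _ | _
  addEdge-elim x y () | false | no _ | _ | yes _ | no _
  addEdge-elim x y () | false | no _ | _ | no _ | _

  private
    Ends : Fin n → Fin n → Set
    Ends x y = (x ≡ u × y ≡ v) ⊎ (x ≡ v × y ≡ u)

    third-vertex : ∀ {x y z w} → Ends x y → Ends z w → z ≢ x → z ≢ y → ⊥
    third-vertex (inj₁ (refl , refl)) (inj₁ (refl , _)) z≢x z≢y = z≢x refl
    third-vertex (inj₁ (refl , refl)) (inj₂ (refl , _)) z≢x z≢y = z≢y refl
    third-vertex (inj₂ (refl , refl)) (inj₁ (refl , _)) z≢x z≢y = z≢y refl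
    third-vertex (inj₂ (refl , refl)) (inj₂ (refl , _)) z≢x z≢y = z≢x refl

    Ends-swap : ∀ {x y} → Ends x y → Ends y x
    Ends-swap (inj₁ (a , b)) = inj₂ (b , a)
    Ends-swap (inj₂ (a , b)) = inj₁ (b , a)

  -- The closing pair is not an edge of `G`, so it is the added one. Using the added pair again
  -- elsewhere would repeat a vertex, because the cycle has at least three; all other edges are
  -- therefore in `G`.
  closing-path : ∀ {m p} → 1 < m → Cycle (addEdge G u v) m p → adj G (p m) (p 0) ≡ false →
                 Path G m p × Ends (p m) (p 0)
  closing-path {m} {p} 1<m (edge , closing , inj) ¬adj = (edge′ , inj) , ends
    where
    ends : Ends (p m) (p 0)
    ends with addEdge-elim (p m) (p 0) closing
    ... | inj₁ h = ⊥-elim (true≢false h ¬adj)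
    ... | inj₂ e = e
    edge′ : ∀ i → i < m → adj G (p i) (p (suc i)) ≡ true
    edge′ i i<m with addEdge-elim (p i) (p (suc i)) (edge i i<m)
    ... | inj₁ h = h
    -- Here `p 0` is itself an end of the closing pair, so `p 1` serves as the third vertex; it
    -- differs from `p m` by `1 < m`.
    edge′ zero i<m | inj₂ e = ⊥-elim (third-vertex ends (Ends-swap e)
      (inj 1 m 1<m ≤-refl) (λ eq → inj 0 1 (s≤s z≤n) i<m (≡-sym eq)))
    edge′ (suc i) i<m | inj₂ e = ⊥-elim (third-vertex ends e
      (inj (suc i) m i<m ≤-refl) (λ eq → inj 0 (suc i) (s≤s z≤n) (<⇒≤ i<m) (≡-sym eq)))

-- As `G` has no such cycle, the one created by adding the pair must use it. After rotation the pair
-- closes the cycle, and the rest is the path, reversed if it runs the wrong way.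
maximal⇒path : ∀ {n} (G : Graph n) m → 1 < m → MaximalCycleFree (suc m) G →
               ∀ x y → x ≢ y → adj G x y ≡ false → ∃ λ p → Path G m p × p 0 ≡ y × p m ≡ x
maximal⇒path {n} G m 1<m (free , maximal) x y x≢y ¬xy = orient aligned
  where
  E : Fin n → Fin n → Bool
  E = addEdge G x y
  aligned : ∃ λ q → Cycle E m q × adj G (q m) (q 0) ≡ false
  aligned with ContainsCycle⇒Cycle E m (maximal x y x≢y ¬xy)
  ... | p , cyc with Finₚ.any? {n = m} (λ i → adj G (p (toℕ i)) (p (suc (toℕ i))) ≟ᵇ false)
  ...   | yes (i , ¬adj) = Cycle-realign E (adj G) (toℕ i) p (Finₚ.toℕ<n i) cyc ¬adj
  ...   | no  none = at-closing (adj G (p m) (p 0)) refl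
    where
    at-closing : ∀ b → adj G (p m) (p 0) ≡ b → ∃ λ q → Cycle E m q × adj G (q m) (q 0) ≡ false
    at-closing false closing = p , cyc , closing
    at-closing true  closing = ⊥-elim (free (Path-close G (edge , proj₂ (proj₂ cyc)) closing))
      where
      edge : ∀ i → i < m → adj G (p i) (p (suc i)) ≡ true
      edge i i<m with adj G (p i) (p (suc i)) in h
      ... | true  = refl
      ... | false = ⊥-elim (none (fromℕ< i<m ,
                      subst (λ t → adj G (p t) (p (suc t)) ≡ false) (≡-sym (Finₚ.toℕ-fromℕ< i<m)) h))
  orient : (∃ λ q → Cycle E m q × adj G (q m) (q 0) ≡ false) → ∃ λ p → Path G m p × p 0 ≡ y × p m ≡ x
  orient (q , cyc , ¬adj) with closing-path G x y 1<m cyc ¬adj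
  ... | path , inj₁ (qm , q0) = q , path , q0 , qm
  ... | path , inj₂ (qm , q0) = (λ i → q (m ∸ i)) , Path-reverse G path , qm , trans (cong q (n∸n≡0 m)) q0

-- Numerical estimates

-- With `E` standing for `2 * e₂ G S`, the two bounds on `E` leave `c * t ≤ 2 * L * s + D`.
-- Multiplied by 80, the right side is at most 2n², and the left side is at least 16nt.
removed-few : ∀ n s t c L D E → 0 < n → s + t ≡ n → n ≤ 5 * c → 160 * L ≤ n → 80 * D ≤ n * n →
              s * s + c * t ≤ E + D → E ≤ s * s + 2 * L * s → 8 * t ≤ n
removed-few n@(suc _) s t c L D E _ s+t≡n n≤5c 160L≤n 80D≤n² lower upper =
  *-cancelˡ-≤ 2 (*-cancelˡ-≤ n (begin
    n * (2 * (8 * t))              ≤⟨ *-monoˡ-≤ (2 * (8 * t)) n≤5c ⟩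
    5 * c * (2 * (8 * t))          ≡⟨ eq₁ c t ⟩
    80 * (c * t)                   ≤⟨ *-monoʳ-≤ 80 ct≤ ⟩
    80 * (2 * L * s + D)           ≡⟨ eq₂ L s D ⟩
    160 * L * s + 80 * D           ≤⟨ +-mono-≤ (*-mono-≤ 160L≤n s≤n) 80D≤n² ⟩
    n * n + n * n                  ≡⟨ eq₃ n ⟩
    n * (2 * n)                    ∎))
  where
  open ≤-Reasoning
  eq₁ : ∀ c t → 5 * c * (2 * (8 * t)) ≡ 80 * (c * t)
  eq₁ = solve-∀
  eq₂ : ∀ L s D → 80 * (2 * L * s + D) ≡ 160 * L * s + 80 * D
  eq₂ = solve-∀
  eq₃ : ∀ n → n * n + n * n ≡ n * (2 * n)
  eq₃ = solve-∀
  s≤n : s ≤ n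
  s≤n = ≤-trans (m≤m+n s t) (≤-reflexive s+t≡n)
  ct≤ : c * t ≤ 2 * L * s + D
  ct≤ = by-sum (s * s + E) (+-mono-≤ lower upper)
    (solve (c ∷ t ∷ s ∷ E ∷ [])) (solve (L ∷ s ∷ D ∷ E ∷ []))

-- Since s ≥ 7n/8 and c ≤ n/4, the degree is at least s/2 - c/4 ≥ 7n/16 - n/16.
large-degree : ∀ n s t c d → s + t ≡ n → 4 * c ≤ n → 8 * t ≤ n → 2 * s ≤ 4 * d + c → 3 * n ≤ 8 * d
large-degree n s t c d refl 4c≤n 8t≤n 2s≤ =
  *-cancelˡ-≤ 4 (by-sum (4 * s + 4 * t + 8 * c)
    (+-mono-≤ (*-monoʳ-≤ 8 2s≤) (+-mono-≤ (*-monoʳ-≤ 2 4c≤n) (*-monoʳ-≤ 2 8t≤n)))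
    (eq₁ s t c) (eq₂ s t c d))
  where
  eq₁ : ∀ s t c → 4 * (3 * (s + t)) + (4 * s + 4 * t + 8 * c) ≡ 8 * (2 * s) + (2 * (4 * c) + 2 * (8 * t))
  eq₁ = solve-∀
  eq₂ : ∀ s t c d → 8 * (4 * d + c) + (2 * (s + t) + 2 * (s + t)) ≡ 4 * (8 * d) + (4 * s + 4 * t + 8 * c)
  eq₂ = solve-∀

-- Three degrees of at least 3n/8 exceed `s` by at least n/8, so the three intersections would force
-- n ≤ 24M.
three-degrees : ∀ n s t c M a b d i j l → 0 < n → s + t ≡ n → 4 * c ≤ n → 8 * t ≤ n → 100 * M ≤ n →
  2 * s ≤ 4 * a + c → 2 * s ≤ 4 * b + c → 2 * s ≤ 4 * d + c → a + b + d ≤ s + (i + (j + l)) →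
  i ≤ M → j ≤ M → l ≤ M → ⊥
three-degrees n@(suc n-1) s t c M a b d i j l _ s+t≡n 4c≤n 8t≤n 100M≤n ha hb hd abd i≤M j≤M l≤M =
  n≮n n (≤-trans (≤-trans (m≤m+n (suc n) (3 * n-1 + 2)) (≤-reflexive (four n-1))) 4n≤n)
  where
  four : ∀ m → suc (suc m) + (3 * m + 2) ≡ 4 * suc m
  four = solve-∀
  large : ∀ x → 2 * s ≤ 4 * x + c → 3 * n ≤ 8 * x
  large x = large-degree n s t c x s+t≡n 4c≤n 8t≤n
  s≤n : s ≤ n
  s≤n = ≤-trans (m≤m+n s t) (≤-reflexive s+t≡n)
  n≤24M : n ≤ 24 * M
  n≤24M = by-sum (8 * n + 8 * a + 8 * b + 8 * d + 8 * s + 8 * (i + (j + l)))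
    (+-mono-≤ (+-mono-≤ (+-mono-≤ (large a ha) (large b hb)) (large d hd))
      (+-mono-≤ (*-monoʳ-≤ 8 abd) (+-mono-≤ (*-monoʳ-≤ 8 s≤n)
        (*-monoʳ-≤ 8 (+-mono-≤ i≤M (+-mono-≤ j≤M l≤M))))))
    (eq₁ n a b d s i j l) (eq₂ n a b d s i j l M)
    where
    eq₁ : ∀ n a b d s i j l → n + (8 * n + 8 * a + 8 * b + 8 * d + 8 * s + 8 * (i + (j + l))) ≡
      3 * n + 3 * n + 3 * n + (8 * (a + b + d) + (8 * s + 8 * (i + (j + l))))
    eq₁ = solve-∀
    eq₂ : ∀ n a b d s i j l M → 8 * a + 8 * b + 8 * d + (8 * (s + (i + (j + l))) + (8 * n + 8 * (M + (M + M)))) ≡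
      24 * M + (8 * n + 8 * a + 8 * b + 8 * d + 8 * s + 8 * (i + (j + l)))
    eq₂ = solve-∀
  4n≤n : 4 * n ≤ n
  4n≤n = ≤-trans (*-monoʳ-≤ 4 n≤24M) (≤-trans (≤-reflexive (eq M)) (≤-trans (m≤m+n (96 * M) (4 * M)) (≤-trans (≤-reflexive (eq′ M)) 100M≤n)))
    where
    eq : ∀ M → 4 * (24 * M) ≡ 96 * M
    eq = solve-∀
    eq′ : ∀ M → 96 * M + 4 * M ≡ 100 * M
    eq′ = solve-∀

-- The chain is s² + C ≤ 2E + D ≤ 4e + D ≤ 4xy - 4M + D ≤ s² - 4M + D, where the last step is the
-- inequality of arithmetic and geometric means.
few-missing : ∀ x y s e M C D E → s * s + C ≤ 2 * E + D → E ≤ 2 * e → e + M ≤ x * y → x + y ≤ s →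
              C + 4 * M ≤ D
few-missing x y s e M C D E lower upper e+M≤xy x+y≤s =
  by-sum (s * s + 2 * E + 4 * e + 4 * (x * y))
    (+-mono-≤ lower (+-mono-≤ (*-monoʳ-≤ 2 upper) (+-mono-≤ (*-monoʳ-≤ 4 e+M≤xy) 4xy≤s²)))
    (eq₁ s C E e M x y) (eq₂ s D E e x y)
  where
  eq₁ : ∀ s C E e M x y → C + 4 * M + (s * s + 2 * E + 4 * e + 4 * (x * y)) ≡
        s * s + C + (2 * E + (4 * (e + M) + 4 * (x * y)))
  eq₁ = solve-∀
  eq₂ : ∀ s D E e x y → 2 * E + D + (2 * (2 * e) + (4 * (x * y) + s * s)) ≡
        D + (s * s + 2 * E + 4 * e + 4 * (x * y))
  eq₂ = solve-∀
  am-gm : ∀ x y → x ≤ y → 4 * (x * y) ≤ (x + y) * (x + y)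
  am-gm x y x≤y with m≤n⇒∃[o]m+o≡n x≤y
  ... | o , refl = ≤-trans (m≤m+n (4 * (x * (x + o))) (o * o)) (≤-reflexive (solve (x ∷ o ∷ [])))
  4xy≤s² : 4 * (x * y) ≤ s * s
  4xy≤s² with ≤-total x y
  ... | inj₁ x≤y = ≤-trans (am-gm x y x≤y) (*-mono-≤ x+y≤s x+y≤s)
  ... | inj₂ y≤x = ≤-trans (≤-trans (≤-reflexive (cong (4 *_) (*-comm x y))) (am-gm y x y≤x))
                     (*-mono-≤ (≤-trans (≤-reflexive (+-comm y x)) x+y≤s) (≤-trans (≤-reflexive (+-comm y x)) x+y≤s))

isqrt : ∀ n → ∃ λ q → q * q ≤ n × n < suc q * suc q
isqrt zero = 0 , z≤n , s≤s z≤n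
isqrt (suc n) with isqrt n
... | q , q²≤n , n<q⁺² with suc q * suc q ≤? suc n
...   | no ¬le = q , m≤n⇒m≤1+n q²≤n , ≰⇒> ¬le
...   | yes le = suc q , le , s≤s (≤-trans n<q⁺² (≤-trans (m≤m+n _ (2 * q + 2)) (≤-reflexive (eq q))))
  where
  eq : ∀ q → suc q * suc q + (2 * q + 2) ≡ suc q + suc q * suc (suc q)
  eq = solve-∀

-- After multiplication by q + 1, the terms in `t` amount to at most (q + 1)²t ≤ 4q²t ≤ 4nt ≤ 20ct,
-- and the term in `a` to at most `M`. Both are covered by 20 times `c * t + 4 * M`.
removed-bound : ∀ n t q c M D r a b → 0 < q → q * q ≤ n → n ≤ 5 * c → c * t + 4 * M ≤ D →
                suc q * a ≤ M → b ≤ t * q → r ≤ t + (a + b) → suc q * r ≤ 20 * D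
removed-bound n t (suc q) c M D r a b _ q²≤n n≤5c small a≤ b≤ r≤ = begin
  (2 + q) * r                                      ≤⟨ *-monoʳ-≤ (2 + q) (≤-trans r≤ (+-monoʳ-≤ t (+-monoʳ-≤ a b≤))) ⟩
  (2 + q) * (t + (a + t * suc q))                  ≡⟨ eq₁ q t a ⟩
  (2 + q) * (2 + q) * t + (2 + q) * a              ≤⟨ +-mono-≤ (*-monoˡ-≤ t (*-mono-≤ (twice q) (twice q))) a≤ ⟩
  2 * suc q * (2 * suc q) * t + M                  ≡⟨ eq₂ q t M ⟩
  4 * (suc q * suc q) * t + M                      ≤⟨ +-monoˡ-≤ M (*-monoˡ-≤ t (*-monoʳ-≤ 4 (≤-trans q²≤n n≤5c))) ⟩
  4 * (5 * c) * t + M                              ≤⟨ m≤m+n _ (79 * M) ⟩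
  4 * (5 * c) * t + M + 79 * M                     ≡⟨ eq₃ c t M ⟩
  20 * (c * t + 4 * M)                             ≤⟨ *-monoʳ-≤ 20 small ⟩
  20 * D                                           ∎
  where
  open ≤-Reasoning
  eq₁ : ∀ q t a → (2 + q) * (t + (a + t * suc q)) ≡ (2 + q) * (2 + q) * t + (2 + q) * a
  eq₁ = solve-∀
  eq₂ : ∀ q t M → 2 * suc q * (2 * suc q) * t + M ≡ 4 * (suc q * suc q) * t + M
  eq₂ = solve-∀
  eq₃ : ∀ c t M → 4 * (5 * c) * t + M + 79 * M ≡ 20 * (c * t + 4 * M)
  eq₃ = solve-∀
  twice : ∀ q → 2 + q ≤ 2 * suc q
  twice q = ≤-trans (m≤m+n (2 + q) q) (≤-reflexive (solve (q ∷ [])))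

^2 : ∀ x → x ^ 2 ≡ x * x
^2 x = cong (x *_) (*-identityʳ x)

-- This is the square of 4r√n ≤ 4(q + 1)r ≤ 80D ≤ CD.
final-bound : ∀ n q r C D → 80 ≤ C → n ≤ suc q * suc q → suc q * r ≤ 20 * D →
              16 * n * r ^ 2 ≤ (C * D) ^ 2
final-bound n q r C D 80≤C n≤ h = begin
  16 * n * r ^ 2                           ≤⟨ *-monoˡ-≤ (r ^ 2) (*-monoʳ-≤ 16 n≤) ⟩
  16 * (suc q * suc q) * r ^ 2             ≡⟨ cong (16 * (suc q * suc q) *_) (^2 r) ⟩
  16 * (suc q * suc q) * (r * r)           ≡⟨ eq₁ (suc q) r ⟩
  4 * (suc q * r) * (4 * (suc q * r))      ≤⟨ *-mono-≤ le le ⟩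
  C * D * (C * D)                          ≡⟨ ≡-sym (^2 (C * D)) ⟩
  (C * D) ^ 2                              ∎
  where
  open ≤-Reasoning
  eq₁ : ∀ p r → 16 * (p * p) * (r * r) ≡ 4 * (p * r) * (4 * (p * r))
  eq₁ = solve-∀
  eq₂ : ∀ D → 4 * (20 * D) ≡ 80 * D
  eq₂ = solve-∀
  le : 4 * (suc q * r) ≤ C * D
  le = ≤-trans (*-monoʳ-≤ 4 h) (≤-trans (≤-reflexive (eq₂ D)) (*-monoˡ-≤ D 80≤C))

-- If n ≤ 8r, then n³ ≤ (q + 1)²(8r)² ≤ (160D)². The bound keeps both sides nonempty after trimming.
removed<n/8 : ∀ n q r C D → 160 ≤ C → n ≤ suc q * suc q → suc q * r ≤ 20 * D →
              (C * D) ^ 2 < n ^ 3 → 8 * r < n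
removed<n/8 n q r C D 160≤C n≤ h CD<n³ = ≰⇒> λ n≤8r → n≮n (n ^ 3) (begin-strict
  n ^ 3                                    ≡⟨ cube n ⟩
  n * (n * n)                              ≤⟨ *-mono-≤ n≤ (*-mono-≤ n≤8r n≤8r) ⟩
  suc q * suc q * (8 * r * (8 * r))        ≡⟨ eq₁ (suc q) r ⟩
  8 * (suc q * r) * (8 * (suc q * r))      ≤⟨ *-mono-≤ le le ⟩
  C * D * (C * D)                          ≡⟨ ≡-sym (^2 (C * D)) ⟩
  (C * D) ^ 2                              <⟨ CD<n³ ⟩
  n ^ 3                                    ∎)
  where
  open ≤-Reasoning
  cube : ∀ n → n ^ 3 ≡ n * (n * n)
  cube n = cong (n *_) (^2 n)
  eq₁ : ∀ p r → p * p * (8 * r * (8 * r)) ≡ 8 * (p * r) * (8 * (p * r))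
  eq₁ = solve-∀
  eq₂ : ∀ D → 8 * (20 * D) ≡ 160 * D
  eq₂ = solve-∀
  le : 8 * (suc q * r) ≤ C * D
  le = ≤-trans (*-monoʳ-≤ 8 h) (≤-trans (≤-reflexive (eq₂ D)) (*-monoˡ-≤ D 160≤C))

deficit-small : ∀ n C D → 0 < n → 80 ≤ C → (C * D) ^ 2 < n ^ 3 → 80 * D ≤ n * n
deficit-small n@(suc _) C D _ 80≤C CD<n³ = ≮⇒≥ λ n²<80D → n≮n (n ^ 3) (begin-strict
  n ^ 3                     ≤⟨ ^-monoʳ-≤ n (n≤1+n 3) ⟩
  n ^ 4                     ≡⟨ fourth n ⟩
  n * n * (n * n)           ≤⟨ *-mono-≤ (<⇒≤ n²<80D) (<⇒≤ n²<80D) ⟩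
  80 * D * (80 * D)         ≤⟨ *-mono-≤ (*-monoˡ-≤ D 80≤C) (*-monoˡ-≤ D 80≤C) ⟩
  C * D * (C * D)           ≡⟨ ≡-sym (^2 (C * D)) ⟩
  (C * D) ^ 2               <⟨ CD<n³ ⟩
  n ^ 3                     ∎)
  where
  open ≤-Reasoning
  fourth : ∀ n → n ^ 4 ≡ n * n * (n * n)
  fourth n = trans (cong (λ m → n * (n * m)) (^2 n)) (≡-sym (*-assoc n n (n * n)))

n-large : ∀ k n → 2 ≤ k → (2 * k) ^ (9 * k * k) ≤ n → 100 * ((2 * k + 1) * (2 * k + 1)) ≤ n
n-large k@(suc _) n 2≤k hn = begin
  100 * ((h + 1) * (h + 1))   ≤⟨ *-monoʳ-≤ 100 (*-mono-≤ h+1≤2h h+1≤2h) ⟩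
  100 * (2 * h * (2 * h))     ≡⟨ eq h ⟩
  -- Here 400 + 624 = 4⁵, and in the exponent below 7 + 29 = 9 · 2 · 2.
  h * h * 400                 ≤⟨ *-monoʳ-≤ (h * h) (≤-trans (m≤m+n 400 624) (^-monoˡ-≤ 5 4≤h)) ⟩
  h * h * h ^ 5               ≡⟨ *-assoc h h (h ^ 5) ⟩
  h ^ 7                       ≤⟨ ^-monoʳ-≤ h (≤-trans (m≤m+n 7 29) (*-mono-≤ (*-monoʳ-≤ 9 2≤k) 2≤k)) ⟩
  h ^ (9 * k * k)             ≤⟨ hn ⟩
  n                           ∎
  where
  open ≤-Reasoning
  h = 2 * k
  4≤h : 4 ≤ h
  4≤h = *-monoʳ-≤ 2 2≤k
  h+1≤2h : h + 1 ≤ 2 * h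
  h+1≤2h = ≤-trans (+-monoʳ-≤ h (≤-trans (s≤s z≤n) 4≤h)) (≤-reflexive (cong (h +_) (≡-sym (+-identityʳ h))))
  eq : ∀ h → 100 * (2 * h * (2 * h)) ≡ h * h * 400
  eq = solve-∀

quarter : ∀ n → 100 ≤ n → ∃ λ c → 4 * c ≤ n × n ≤ 5 * c
quarter n 100≤n = c , 4c≤n , n≤5c
  where
  c = n / 4
  n≡ : n ≡ n % 4 + 4 * c
  n≡ = trans (m≡m%n+[m/n]*n n 4) (cong (n % 4 +_) (*-comm c 4))
  4c≤n : 4 * c ≤ n
  4c≤n = ≤-trans (m≤n+m (4 * c) (n % 4)) (≤-reflexive (≡-sym n≡))
  n<4+4c : n < 4 + 4 * c
  n<4+4c = ≤-trans (s≤s (≤-reflexive n≡)) (+-monoˡ-≤ (4 * c) (m%n<n n 4))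
  4≤c : 4 ≤ c
  4≤c = ≮⇒≥ λ c<4 → n≮n 19 (≤-trans (m≤m+n 20 80) (≤-trans 100≤n
          (≤-trans (≤-pred n<4+4c) (+-monoʳ-≤ 3 (≤-trans (*-monoʳ-≤ 4 (<⇒≤ c<4)) ≤-refl)))))
  n≤5c : n ≤ 5 * c
  n≤5c = ≤-trans (<⇒≤ n<4+4c) (+-monoˡ-≤ (4 * c) 4≤c)

-- Edges as ordered pairs, and deletion of vertices of low degree

sumᴸ-allFin : ∀ n (f : Fin n → ℕ) → sumᴸ (map f (allFin n)) ≡ sum f
sumᴸ-allFin n f = trans (cong sumᴸ (map-tabulate id f)) (sumᴸ-tabulate n f)
  where
  sumᴸ-tabulate : ∀ n (f : Fin n → ℕ) → sumᴸ (tabulate f) ≡ sum f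
  sumᴸ-tabulate zero    f = refl
  sumᴸ-tabulate (suc n) f = cong (f zero +_) (sumᴸ-tabulate n (f ∘ suc))

e₂-all : ∀ {n} (G : Graph n) → e₂ G (λ _ → true) ≡ 2 * edgeCount G
e₂-all {n} G = begin-equality
  e₂ G (λ _ → true)
    ≡⟨ ∑∑-cong {n} {n} split ⟩
  sum (λ x → sum (λ y → up x y + up y x))
    ≡⟨ ∑∑-distrib-+ up (λ x y → up y x) ⟩
  sum (λ x → sum (up x)) + sum (λ x → sum (λ y → up y x))
    ≡⟨ cong (sum (λ x → sum (up x)) +_) (∑-comm (λ x y → up y x)) ⟩
  sum (λ x → sum (up x)) + sum (λ x → sum (up x))
    ≡⟨ cong₂ _+_ edges (trans edges (≡-sym (+-identityʳ _))) ⟩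
  2 * edgeCount G ∎
  where
  open ≤-Reasoning
  up : Fin n → Fin n → ℕ
  up x y = ⟦ adj G x y ∧ does (x <?ᶠ y) ⟧
  split : ∀ x y → ⟦ adj G x y ⟧ ≡ up x y + up y x
  split x y with Finₚ.<-cmp x y
  ... | tri< x<y _ y≮x rewrite does-true (x <?ᶠ y) x<y | does-false (y <?ᶠ x) y≮x = pointwise (adj G x y) (adj G y x)
    where
    pointwise : ∀ a b → ⟦ a ⟧ ≡ ⟦ a ∧ true ⟧ + ⟦ b ∧ false ⟧
    pointwise false false = refl
    pointwise false true  = refl
    pointwise true  false = refl
    pointwise true  true  = refl
  ... | tri≈ _ refl _ rewrite irrefl G x = refl
  ... | tri> x≮y _ y<x rewrite does-false (x <?ᶠ y) x≮y | does-true (y <?ᶠ x) y<x | sym G y x = pointwise (adj G x y)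
    where
    pointwise : ∀ a → ⟦ a ⟧ ≡ ⟦ a ∧ false ⟧ + ⟦ a ∧ true ⟧
    pointwise false = refl
    pointwise true  = refl
  edges : sum (λ x → sum (up x)) ≡ edgeCount G
  edges = ≡-sym (trans (sumᴸ-allFin n (λ x → sumᴸ (map (up x) (allFin n))))
                       (sum-cong-≗ {n} (λ x → sumᴸ-allFin n (up x))))

-- Deleting a vertex of degree below s/2 - c/4 from a set of s vertices raises 2 e₂ - s² by at
-- least c.
core : ∀ {n} (G : Graph n) c D s (S : Pred n) t → # S ≡ s → s + t ≡ n →
       s * s + c * t ≤ 2 * e₂ G S + D →
       ∃ λ S′ → ∃ λ t′ → # S′ + t′ ≡ n × # S′ * # S′ + c * t′ ≤ 2 * e₂ G S′ + D ×
         (∀ x → S′ x ≡ true → 2 * # S′ ≤ 4 * deg G S′ x + c)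
core G c D s S t #S s+t≡n inv
  with Finₚ.any? (λ x → (S x ≟ᵇ true) ×-dec (4 * deg G S x + c <? 2 * s))
core G c D s S t refl s+t≡n inv | no ¬low =
  S , t , s+t≡n , inv , λ x sx → ≮⇒≥ (λ low → ¬low (x , sx , low))
core G c D zero    S t #S s+t≡n inv | yes (x , sx , ())
core G c D (suc s) S t #S s+t≡n inv | yes (x , sx , low) =
  core G c D s (S ∖ x) (suc t) (suc-injective (trans (≡-sym (#-∖-∈ S x sx)) #S))
    (trans (+-suc s t) s+t≡n)
    (by-sum (4 * d + 2 * suc s)
      (+-mono-≤ low (≤-trans inv (≤-reflexive (cong (λ e → 2 * e + D) (e₂-∖ G S x sx)))))
      (eq₁ c s t d) (eq₂ D s d (e₂ G (S ∖ x))))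
  where
  d = deg G S x
  eq₁ : ∀ c s t d → s * s + c * suc t + (4 * d + 2 * suc s) ≡ suc (4 * d + c) + (suc s * suc s + c * t)
  eq₁ = solve-∀
  eq₂ : ∀ D s d E → 2 * suc s + (2 * (E + 2 * d) + D) ≡ 2 * E + D + (4 * d + 2 * suc s)
  eq₂ = solve-∀

-- Non-adjacent pairs and trimming of the two sides

subset : ∀ {n} → Pred n → Subset n
subset = Vec.tabulate

∣subset∣ : ∀ {n} (p : Pred n) → ∣ subset p ∣ ≡ # p
∣subset∣ {zero}  p = refl
∣subset∣ {suc n} p with p zero
... | true  = cong suc (∣subset∣ (p ∘ suc))
... | false = ∣subset∣ (p ∘ suc)

∈-subset⁺ : ∀ {n} (p : Pred n) {x} → p x ≡ true → x ∈ subset p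
∈-subset⁺ p {x} h = lookup⇒[]= x (subset p) (trans (lookup∘tabulate p x) h)

∈-subset⁻ : ∀ {n} (p : Pred n) {x} → x ∈ subset p → p x ≡ true
∈-subset⁻ p {x} h = trans (≡-sym (lookup∘tabulate p x)) ([]=⇒lookup h)

⟦⟧-≤-+ : ∀ {a b c} → (a ≡ true → b ≡ true ⊎ c ≡ true) → ⟦ a ⟧ ≤ ⟦ b ⟧ + ⟦ c ⟧
⟦⟧-≤-+ {false} h = z≤n
⟦⟧-≤-+ {true} h with h refl
... | inj₁ refl = s≤s z≤n
... | inj₂ refl = m≤n+m 1 _

#-≤-+ : ∀ {n} (p q r : Pred n) → (∀ x → p x ≡ true → q x ≡ true ⊎ r x ≡ true) → # p ≤ # q + # r
#-≤-+ p q r h = ≤-trans (sum-mono (λ x → ⟦⟧-≤-+ (h x)))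
  (≤-reflexive (∑-distrib-+ (λ x → ⟦ q x ⟧) (λ x → ⟦ r x ⟧)))

#-+-≤ : ∀ {n} (p q r : Pred n) → (∀ x → q x ≡ true → p x ≡ true) → (∀ x → r x ≡ true → p x ≡ true) →
        (∀ x → q x ≡ true → r x ≡ true → ⊥) → # q + # r ≤ # p
#-+-≤ p q r q⊆p r⊆p disjoint = ≤-trans
  (≤-reflexive (≡-sym (∑-distrib-+ (λ x → ⟦ q x ⟧) (λ x → ⟦ r x ⟧))))
  (sum-mono (λ x → pointwise (q⊆p x) (r⊆p x) (disjoint x)))
  where
  pointwise : ∀ {a b c} → (b ≡ true → a ≡ true) → (c ≡ true → a ≡ true) →
              (b ≡ true → c ≡ true → ⊥) → ⟦ b ⟧ + ⟦ c ⟧ ≤ ⟦ a ⟧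
  pointwise {b = false}             _   c⇒a _ = ⟦⟧-mono c⇒a
  pointwise {b = true} {c = false}  b⇒a _   _ = ⟦⟧-mono b⇒a
  pointwise {b = true} {c = true}   _   _   d = ⊥-elim (d refl refl)

#-split : ∀ {n} (p q : Pred n) → # p ≤ # (λ x → p x ∧ not (q x)) + # (λ x → p x ∧ q x)
#-split p q = #-≤-+ p (λ x → p x ∧ not (q x)) (λ x → p x ∧ q x) (λ x → pointwise (p x) (q x))
  where
  pointwise : ∀ a b → a ≡ true → a ∧ not b ≡ true ⊎ a ∧ b ≡ true
  pointwise true true  _ = inj₂ refl
  pointwise true false _ = inj₁ refl

module _ {n : ℕ} (G : Graph n) {S X Y : Pred n} (B : Bipartition G S X Y) where

  cross missing : ℕ
  cross   = sum (λ x → sum (λ y → ⟦ X x ∧ Y y ∧ adj G x y ⟧))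
  missing = sum (λ x → sum (λ y → ⟦ X x ∧ Y y ∧ not (adj G x y) ⟧))

  #S≤#X+#Y : # S ≤ # X + # Y
  #S≤#X+#Y = #-≤-+ S X Y (cover B)

  #X+#Y≤#S : # X + # Y ≤ # S
  #X+#Y≤#S = #-+-≤ S X Y (X⊆S B) (Y⊆S B) (disj B)

  e₂≤2cross : e₂ G S ≤ 2 * cross
  e₂≤2cross = begin
    e₂ G S
      ≤⟨ sum-mono (λ x → sum-mono (λ y → ⟦⟧-≤-+ (sides x y))) ⟩
    sum (λ x → sum (λ y → E x y + E y x))
      ≡⟨ ∑∑-distrib-+ E (λ x y → E y x) ⟩
    cross + sum (λ x → sum (λ y → E y x))
      ≡⟨ cong (cross +_) (trans (∑-comm (λ x y → E y x)) (≡-sym (+-identityʳ cross))) ⟩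
    2 * cross ∎
    where
    open ≤-Reasoning
    E : Fin n → Fin n → ℕ
    E x y = ⟦ X x ∧ Y y ∧ adj G x y ⟧
    sides : ∀ x y → S x ∧ S y ∧ adj G x y ≡ true →
            X x ∧ Y y ∧ adj G x y ≡ true ⊎ X y ∧ Y x ∧ adj G y x ≡ true
    sides x y h = sides′ (cover B x (∧-fst h)) (cover B y (∧-fst {S y} (∧-snd {S x} h)))
      where
      xy : adj G x y ≡ true
      xy = ∧-snd {S y} (∧-snd {S x} h)
      sides′ : X x ≡ true ⊎ Y x ≡ true → X y ≡ true ⊎ Y y ≡ true →
               X x ∧ Y y ∧ adj G x y ≡ true ⊎ X y ∧ Y x ∧ adj G y x ≡ true
      sides′ (inj₁ hx) (inj₁ hy) = ⊥-elim (indX B x y hx hy xy)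
      sides′ (inj₁ hx) (inj₂ hy) = inj₁ (∧-intro hx (∧-intro hy xy))
      sides′ (inj₂ hx) (inj₁ hy) = inj₂ (∧-intro hy (∧-intro hx (trans (sym G y x) xy)))
      sides′ (inj₂ hx) (inj₂ hy) = ⊥-elim (indY B x y hx hy xy)

  cross+missing≤ : cross + missing ≤ # X * # Y
  cross+missing≤ = ≤-reflexive (begin-equality
    cross + missing
      ≡⟨ ≡-sym (∑∑-distrib-+ (λ x y → ⟦ X x ∧ Y y ∧ adj G x y ⟧) (λ x y → ⟦ X x ∧ Y y ∧ not (adj G x y) ⟧)) ⟩
    sum (λ x → sum (λ y → ⟦ X x ∧ Y y ∧ adj G x y ⟧ + ⟦ X x ∧ Y y ∧ not (adj G x y) ⟧))
      ≡⟨ ∑∑-cong {n} {n} (λ x y → pointwise (X x) (Y y) (adj G x y)) ⟩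
    sum (λ x → sum (λ y → ⟦ X x ⟧ * ⟦ Y y ⟧))
      ≡⟨ sum-cong-≗ {n} (λ x → ≡-sym (*-distribˡ-sum ⟦ X x ⟧ (λ y → ⟦ Y y ⟧))) ⟩
    sum (λ x → ⟦ X x ⟧ * # Y)
      ≡⟨ ≡-sym (*-distribʳ-sum (# Y) (λ x → ⟦ X x ⟧)) ⟩
    # X * # Y ∎)
    where
    open ≤-Reasoning
    pointwise : ∀ a b c → ⟦ a ∧ b ∧ c ⟧ + ⟦ a ∧ b ∧ not c ⟧ ≡ ⟦ a ⟧ * ⟦ b ⟧
    pointwise false b     c     = refl
    pointwise true  false c     = refl
    pointwise true  true  false = refl
    pointwise true  true  true  = refl

  -- The parameter will be the integer part of √n, which balances the losses: at most missing/(q +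
  -- 1) vertices of `X`, and at most `q` vertices of `Y` for each vertex outside `S`.
  module Trim (q : ℕ) where

    non-nbrs : Fin n → Pred n
    non-nbrs x y = Y y ∧ not (adj G x y)

    badX badY X′ Y′ : Pred n
    badX x = does (suc q ≤? # (non-nbrs x))
    badY y = does (Finₚ.any? (λ v → (S v ≟ᵇ false) ×-dec ((adj G v y ≟ᵇ true) ×-dec (deg G Y v ≤? q))))
    X′ x = X x ∧ not (badX x)
    Y′ y = Y y ∧ not (badY y)

    few-badX : suc q * # (λ x → X x ∧ badX x) ≤ missing
    few-badX = ≤-trans (≤-reflexive (*-distribˡ-sum (suc q) (λ x → ⟦ X x ∧ badX x ⟧))) (sum-mono pointwise)
      where
      pointwise : ∀ x → suc q * ⟦ X x ∧ badX x ⟧ ≤ sum (λ y → ⟦ X x ∧ Y y ∧ not (adj G x y) ⟧)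
      pointwise x with X x
      ... | false = ≤-trans (≤-reflexive (*-zeroʳ (suc q))) z≤n
      ... | true with badX x in h
      ...   | true  = ≤-trans (≤-reflexive (*-identityʳ (suc q))) (true-does (suc q ≤? # (non-nbrs x)) h)
      ...   | false = ≤-trans (≤-reflexive (*-zeroʳ (suc q))) z≤n

    -- The bad vertices of `Y` are covered by the sets of neighbours in `Y` of the vertices outside
    -- `S` with `low`, each of size at most `q`.
    few-badY : # (λ y → Y y ∧ badY y) ≤ # (not ∘ S) * q
    few-badY = begin
      # (λ y → Y y ∧ badY y)                              ≤⟨ sum-mono covered ⟩
      sum (λ y → sum (λ v → ⟦ not (S v) ∧ low v ∧ nbrs G Y v y ⟧))  ≡⟨ ∑-comm (λ y v → ⟦ not (S v) ∧ low v ∧ nbrs G Y v y ⟧) ⟩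
      sum (λ v → sum (λ y → ⟦ not (S v) ∧ low v ∧ nbrs G Y v y ⟧))  ≤⟨ sum-mono few ⟩
      sum (λ v → ⟦ not (S v) ⟧ * q)                       ≡⟨ ≡-sym (*-distribʳ-sum q (λ v → ⟦ not (S v) ⟧)) ⟩
      # (not ∘ S) * q                                     ∎
      where
      open ≤-Reasoning
      low : Pred n
      low v = does (deg G Y v ≤? q)
      covered : ∀ y → ⟦ Y y ∧ badY y ⟧ ≤ sum (λ v → ⟦ not (S v) ∧ low v ∧ nbrs G Y v y ⟧)
      covered y with Y y in hy
      ... | false = z≤n
      ... | true with Finₚ.any? (λ v → (S v ≟ᵇ false) ×-dec ((adj G v y ≟ᵇ true) ×-dec (deg G Y v ≤? q)))
      ...   | no _ = z≤n
      ...   | yes (v , sv , vy , small) =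
        ≤-trans (≤-reflexive (cong ⟦_⟧ (≡-sym (∧-intro (cong not sv)
                  (∧-intro (does-true (deg G Y v ≤? q) small) vy)))))
                (≤-sum (λ v → ⟦ not (S v) ∧ low v ∧ adj G v y ⟧) v)
      few : ∀ v → sum (λ y → ⟦ not (S v) ∧ low v ∧ nbrs G Y v y ⟧) ≤ ⟦ not (S v) ⟧ * q
      few v with S v
      ... | true  = ≤-reflexive (sum-replicate-zero n)
      ... | false with low v in h
      ...   | true  = ≤-trans (true-does (deg G Y v ≤? q) h) (≤-reflexive (≡-sym (+-identityʳ q)))
      ...   | false = ≤-trans (≤-reflexive (sum-replicate-zero n)) z≤n

    -- For a non-adjacent pair, the neighbours in `Y` of the blocking vertex `v` are all
    -- non-neighbours of `x`. As `x` is not bad there are at most `q` of them, which makes `y` bad.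
    complete : (∀ x y → X x ≡ true → Y y ≡ true → adj G x y ≡ false →
                 ∃ λ v → S v ≡ false × adj G v y ≡ true ×
                   (∀ y′ → Y y′ ≡ true → adj G v y′ ≡ true → adj G x y′ ≡ false)) →
               ∀ x y → X′ x ≡ true → Y′ y ≡ true → adj G x y ≡ true
    complete block x y hx hy with adj G x y in xy
    ... | true  = refl
    ... | false =
      let (v , sv , vy , none) = block x y (∧-fst hx) (∧-fst hy) xy
          few  = ≤-pred (≰⇒> (false-does (suc q ≤? # (non-nbrs x)) (not-true (∧-snd {X x} hx))))
          le   = #-mono (nbrs G Y v) (non-nbrs x) λ y′ h →
                   ∧-intro (nbrs-∈ G Y h) (cong not (none y′ (nbrs-∈ G Y h) (nbrs-adj G Y h)))
      in ⊥-elim (false-does (Finₚ.any? _) (not-true (∧-snd {Y y} hy)) (v , sv , vy , ≤-trans le few))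

-- Assembly

-- Here ε is eliminated through D = n² - 4e(G) = 4εn^(3/2): the range of ε becomes 4e(G) < n² and
-- (500k²D)² < n³, and a loss of at most 250k²εn = 250k²D/(4√n) vertices is stated in squared form.
theorem3p1 : (k n : ℕ) → 2 ≤ k → (2 * k) ^ (9 * k * k) ≤ n →
    (G : Graph n) → MaximalCycleFree (2 * k + 1) G →
    4 * edgeCount G < n * n →
    (500 * k * k * (n * n ∸ 4 * edgeCount G)) ^ 2 < n ^ 3 →
    Σ (Subset n) λ A → Σ (Subset n) λ B →
    InducedCompleteBipartite G A B ×
    16 * n * (n ∸ (∣ A ∣ + ∣ B ∣)) ^ 2 ≤ (250 * k * k * (n * n ∸ 4 * edgeCount G)) ^ 2
theorem3p1 (suc zero) _ (s≤s ())
theorem3p1 k@(suc (suc j)) n 2≤k n-huge G maximal 4e<n² small-deficit =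
  conclude (core G c D n (λ _ → true) 0 (#-all n) (+-identityʳ n) initial)
  where
  L D c q : ℕ
  L = 2 * k + 1
  D = n * n ∸ 4 * edgeCount G
  free : CycleFree L G
  free = proj₁ maximal
  100L²≤n : 100 * (L * L) ≤ n
  100L²≤n = n-large k n 2≤k n-huge
  5≤L : 5 ≤ L
  5≤L = +-monoˡ-≤ 1 (*-monoʳ-≤ 2 2≤k)
  100≤n : 100 ≤ n
  100≤n = ≤-trans (*-monoʳ-≤ 100 (*-mono-≤ 1≤L 1≤L)) 100L²≤n
    where
    1≤L : 1 ≤ L
    1≤L = ≤-trans (s≤s z≤n) 5≤L
  0<n : 0 < n
  0<n = ≤-trans (s≤s z≤n) 100≤n
  160L≤n : 160 * L ≤ n
  160L≤n = ≤-trans (*-monoˡ-≤ L (m≤m+n 160 340)) (≤-trans (≤-reflexive (*-assoc 100 5 L))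
             (≤-trans (*-monoʳ-≤ 100 (*-monoˡ-≤ L 5≤L)) 100L²≤n))
  ≤akk : ∀ a b → b ≤ a → b ≤ a * k * k
  ≤akk a b b≤a = ≤-trans b≤a (≤-trans (m≤m*n a k) (m≤m*n (a * k) k))
  80D≤n² : 80 * D ≤ n * n
  80D≤n² = deficit-small n (500 * k * k) D 0<n (≤akk 500 80 (m≤m+n 80 420)) small-deficit
  c = proj₁ (quarter n 100≤n)
  4c≤n : 4 * c ≤ n
  4c≤n = proj₁ (proj₂ (quarter n 100≤n))
  n≤5c : n ≤ 5 * c
  n≤5c = proj₂ (proj₂ (quarter n 100≤n))
  q = proj₁ (isqrt n)
  q²≤n : q * q ≤ n
  q²≤n = proj₁ (proj₂ (isqrt n))
  n<[1+q]² : n < suc q * suc q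
  n<[1+q]² = proj₂ (proj₂ (isqrt n))
  0<q : 0 < q
  0<q = ≮⇒≥ λ q<1 → n≮n 1 (≤-trans (s≤s (≤-trans (s≤s z≤n) 100≤n)) (≤-trans n<[1+q]² (*-mono-≤ q<1 q<1)))

  -- The invariant of `core` starts as an equality; the truncated subtraction in `D` is exact
  -- because `4 * edgeCount G < n * n`.
  initial : n * n + c * 0 ≤ 2 * e₂ G (λ _ → true) + D
  initial = ≤-reflexive (begin-equality
    n * n + c * 0                    ≡⟨ trans (cong (n * n +_) (*-zeroʳ c)) (+-identityʳ _) ⟩
    n * n                            ≡⟨ ≡-sym (m+[n∸m]≡n (<⇒≤ 4e<n²)) ⟩
    4 * edgeCount G + D              ≡⟨ cong (_+ D) (*-assoc 2 2 (edgeCount G)) ⟩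
    2 * (2 * edgeCount G) + D        ≡⟨ cong (λ e → 2 * e + D) (≡-sym (e₂-all G)) ⟩
    2 * e₂ G (λ _ → true) + D        ∎)
    where open ≤-Reasoning

  Goal : Set
  Goal = Σ (Subset n) λ A → Σ (Subset n) λ B → InducedCompleteBipartite G A B ×
    16 * n * (n ∸ (∣ A ∣ + ∣ B ∣)) ^ 2 ≤ (250 * k * k * D) ^ 2

  conclude : (∃ λ S → ∃ λ t → # S + t ≡ n × # S * # S + c * t ≤ 2 * e₂ G S + D ×
               (∀ x → S x ≡ true → 2 * # S ≤ 4 * deg G S x + c)) → Goal
  conclude (S , t , s+t≡n , lower , degrees) = assemble (bipartite G S j free triple u u∈S)
    where
    8t≤n : 8 * t ≤ n
    8t≤n = removed-few n (# S) t c L D (2 * e₂ G S) 0<n s+t≡n n≤5c 160L≤n 80D≤n² lower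
             (e₂≤ G k (s≤s z≤n) free (# S) S refl)
    triple : ∀ x y z → S x ≡ true → S y ≡ true → S z ≡ true →
             com G S x y ≤ L * L → com G S x z ≤ L * L → com G S y z ≤ L * L → ⊥
    triple x y z sx sy sz = three-degrees n (# S) t c (L * L) (deg G S x) (deg G S y) (deg G S z)
      (com G S x y) (com G S x z) (com G S y z) 0<n s+t≡n 4c≤n 8t≤n 100L²≤n
      (degrees x sx) (degrees y sy) (degrees z sz) (deg+deg+deg≤ G S x y z)
    0<#S : 0 < # S
    0<#S = ≮⇒≥ λ #S<1 → n≮n n (begin-strict
      n              <⟨ m<m+n n (≤-trans 0<n (m≤m+n n (6 * n))) ⟩
      n + 7 * n      ≡⟨⟩
      8 * n          ≡⟨ cong (8 *_) (≡-sym (trans (cong (_+ t) (≡-sym (n≤0⇒n≡0 (≤-pred #S<1)))) s+t≡n)) ⟩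
      8 * t          ≤⟨ 8t≤n ⟩
      n              ∎)
      where open ≤-Reasoning
    u : Fin n
    u = proj₁ (#-pos⇒∃ S 0<#S)
    u∈S : S u ≡ true
    u∈S = proj₂ (#-pos⇒∃ S 0<#S)

    assemble : (∃ λ X → ∃ λ Y → Bipartition G S X Y) → Goal
    assemble (X , Y , B) = subset X′ , subset Y′ ,
      ( nonempty X′ 0<#X′ , nonempty Y′ 0<#Y′
      , (λ z hx hy → disj B z (in-X hx) (in-Y hy))
      , (λ x y hx hy → complete block x y (∈-subset⁻ X′ hx) (∈-subset⁻ Y′ hy))
      , (λ x y hx hy → ¬true (indX B x y (in-X hx) (in-X hy)))
      , (λ x y hx hy → ¬true (indY B x y (in-Y hx) (in-Y hy)))) ,
      subst (λ m → 16 * n * (n ∸ m) ^ 2 ≤ (250 * k * k * D) ^ 2)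
        (≡-sym (cong₂ _+_ (∣subset∣ X′) (∣subset∣ Y′)))
        (final-bound n q r (250 * k * k) D (≤akk 250 80 (m≤m+n 80 170)) (<⇒≤ n<[1+q]²) r-bound)
      where
      open Trim G B q
      ¬true : ∀ {b} → ¬ (b ≡ true) → b ≡ false
      ¬true {false} _ = refl
      ¬true {true}  h = ⊥-elim (h refl)
      in-X : ∀ {x} → x ∈ subset X′ → X x ≡ true
      in-X h = ∧-fst (∈-subset⁻ X′ h)
      in-Y : ∀ {y} → y ∈ subset Y′ → Y y ≡ true
      in-Y h = ∧-fst (∈-subset⁻ Y′ h)
      nonempty : ∀ p → 0 < # p → Nonempty (subset p)
      nonempty p h = let (x , px) = #-pos⇒∃ p h in x , ∈-subset⁺ p px
      block : ∀ x y → X x ≡ true → Y y ≡ true → adj G x y ≡ false →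
              ∃ λ v → S v ≡ false × adj G v y ≡ true ×
                (∀ y′ → Y y′ ≡ true → adj G v y′ ≡ true → adj G x y′ ≡ false)
      block x y hx hy ¬xy
        with maximal⇒path G (2 * k) (≤-trans (s≤s (s≤s z≤n)) (*-monoʳ-≤ 2 2≤k))
               (subst (λ l → MaximalCycleFree l G) (+-comm (2 * k) 1) maximal)
               x y (λ { refl → disj B x hx hy }) ¬xy
      ... | p , path , refl , refl = blocker G S j free triple B path hy hx
      a b r : ℕ
      a = # (λ x → X x ∧ badX x)
      b = # (λ y → Y y ∧ badY y)
      r = n ∸ (# X′ + # Y′)
      outside≤t : # (not ∘ S) ≤ t
      outside≤t = +-cancelˡ-≤ (# S) _ _ (≤-trans
        (#-+-≤ (λ _ → true) S (not ∘ S) (λ _ _ → refl) (λ _ _ → refl) (λ x h h′ → true≢false h (not-true h′)))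
        (≤-reflexive (trans (#-all n) (≡-sym s+t≡n))))
      r≤ : r ≤ t + (a + b)
      r≤ = m≤n+o⇒m∸n≤o n (# X′ + # Y′) (begin
        n                                   ≡⟨ ≡-sym s+t≡n ⟩
        # S + t                             ≤⟨ +-monoˡ-≤ t (#S≤#X+#Y G B) ⟩
        # X + # Y + t                       ≤⟨ +-monoˡ-≤ t (+-mono-≤ (#-split X badX) (#-split Y badY)) ⟩
        # X′ + a + (# Y′ + b) + t           ≡⟨ rearr (# X′) a (# Y′) b t ⟩
        # X′ + # Y′ + (t + (a + b))         ∎)
        where
        open ≤-Reasoning
        rearr : ∀ x a y b t → x + a + (y + b) + t ≡ x + y + (t + (a + b))
        rearr = solve-∀
      r-bound : suc q * r ≤ 20 * D
      r-bound = removed-bound n t q c (missing G B) D r a b 0<q q²≤n n≤5c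
        (few-missing (# X) (# Y) (# S) (cross G B) (missing G B) (c * t) D (e₂ G S) lower
          (e₂≤2cross G B) (cross+missing≤ G B) (#X+#Y≤#S G B))
        few-badX (≤-trans few-badY (*-monoˡ-≤ q outside≤t)) r≤
      8r<n : 8 * r < n
      8r<n = removed<n/8 n q r (500 * k * k) D (≤akk 500 160 (m≤m+n 160 340)) (<⇒≤ n<[1+q]²) r-bound small-deficit
      -- A vertex of the opposite side has at least 3n/8 neighbours in `S`, all of them in `Z`.
      large-side : ∀ {Z W} → Bipartition G S Z W → 3 * n ≤ 8 * # Z
      large-side B′ = let (w , hw) = y₀ B′ in ≤-trans
        (large-degree n (# S) t c (deg G S w) s+t≡n 4c≤n 8t≤n (degrees w (Y⊆S B′ w hw)))
        (*-monoʳ-≤ 8 (deg≤#X G S j free triple B′ w hw))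
      -- A side with at least 3n/8 vertices loses at most r < n/8 of them.
      survives : ∀ x y x′ y′ → 3 * n ≤ 8 * x → x + y ≤ # S → y′ ≤ y → n ≤ x′ + y′ + r → 0 < x′
      survives x y x′ y′ 3n≤8x x+y≤ y′≤y n≤ = ≮⇒≥ λ x′<1 → n≮n n (begin-strict
        n                 ≤⟨ m≤m+n n (2 * n) ⟩
        3 * n             ≤⟨ 3n≤8x ⟩
        8 * x             ≤⟨ *-monoʳ-≤ 8 x≤ ⟩
        8 * (x′ + r)      ≤⟨ *-monoʳ-≤ 8 (+-monoˡ-≤ r (≤-pred x′<1)) ⟩
        8 * r             <⟨ 8r<n ⟩
        n                 ∎)
        where
        open ≤-Reasoning
        rearr : ∀ x y r → x + y + r ≡ x + r + y
        rearr = solve-∀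
        x≤ : x ≤ x′ + r
        x≤ = +-cancelʳ-≤ y x (x′ + r) (begin
          x + y           ≤⟨ x+y≤ ⟩
          # S             ≤⟨ ≤-trans (m≤m+n (# S) t) (≤-reflexive s+t≡n) ⟩
          n               ≤⟨ n≤ ⟩
          x′ + y′ + r     ≤⟨ +-monoˡ-≤ r (+-monoʳ-≤ x′ y′≤y) ⟩
          x′ + y + r      ≡⟨ rearr x′ y r ⟩
          x′ + r + y      ∎)
      n≤X′+Y′+r : n ≤ # X′ + # Y′ + r
      n≤X′+Y′+r = m≤n+m∸n n (# X′ + # Y′)
      0<#X′ : 0 < # X′
      0<#X′ = survives (# X) (# Y) (# X′) (# Y′) (large-side B) (#X+#Y≤#S G B)
        (#-mono Y′ Y (λ _ → ∧-fst)) n≤X′+Y′+r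
      0<#Y′ : 0 < # Y′
      0<#Y′ = survives (# Y) (# X) (# Y′) (# X′) (large-side (swap B))
        (≤-trans (≤-reflexive (+-comm (# Y) (# X))) (#X+#Y≤#S G B))
        (#-mono X′ X (λ _ → ∧-fst))
        (≤-trans n≤X′+Y′+r (≤-reflexive (cong (_+ r) (+-comm (# X′) (# Y′)))))
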